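{- Let $A\subseteq[N]$ have distinct subset products and let $\mathcal{P}_{\square}=\{p\in\mathcal{P}_{\mathrm{med}}: p^2\mid a\text{ for some }a\in A\}$. Then $$|A|\le \pi(N)+\tfrac12\pi(N^{1/2})+\tfrac12|\mathcal{P}_{\square}|+O(N^{5/12+o(1)}),$$ i.e. for every $\varepsilon>0$ there is $C_\varepsilon$ (independent of $N$ and $A$) such that $|A|\le \pi(N)+\tfrac12\pi(N^{1/2})+\tfrac12|\mathcal{P}_{\square}|+C_\varepsilon N^{5/12+\varepsilon}$.
   Context: A finite set $A\subset\mathbb{N}$ has distinct subset products if for any two distinct subsets $B,C\subseteq A$, $\prod_{b\in B}b\neq\prod_{c\in C}c$. $\pi(x)$ is the number of primes $\le x$; $\mathcal{P}_{\mathrm{med}}$ is the set of primes in $(N^{1/3},N^{1/2}]$. -}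

module Defs where

open import Data.Nat using (ℕ; zero; suc; _+_; _*_; _∸_; _^_; _≤_; _<_)
open import Data.Nat.Properties using (_≤?_; _<?_)
open import Data.Nat.Divisibility using (_∣_; _∣?_)
open import Data.Nat.Primality using (Prime; prime?)
open import Data.Bool using (Bool; true; false)
open import Data.Fin using (Fin) renaming (zero to fzero; suc to fsuc)
open import Data.Fin.Subset using (Subset)
open import Data.Fin.Properties using (any?)
open import Data.Vec using ([]; _∷_)
open import Data.List using (List; length; filter; upTo)
open import Data.Product using (_×_; ∃)
open import Relation.Nullary using (¬_)
open import Relation.Nullary.Decidable using (_×-dec_)
open import Relation.Binary.PropositionalEquality using (_≡_)
open import Function.Definitions using (Injective)

subsetProd : ∀ {n} → (Fin n → ℕ) → Subset n → ℕ
subsetProd {zero}  a []            = 1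
subsetProd {suc n} a (true  ∷ s)   = a fzero * subsetProd (λ i → a (fsuc i)) s
subsetProd {suc n} a (false ∷ s)   = subsetProd (λ i → a (fsuc i)) s

DistinctSubsetProducts : ∀ {n} → (Fin n → ℕ) → Set
DistinctSubsetProducts {n} a =
  (S T : Subset n) → subsetProd a S ≡ subsetProd a T → S ≡ T

SubsetOfRange : ℕ → ∀ {n} → (Fin n → ℕ) → Set
SubsetOfRange N {n} a = Injective _≡_ _≡_ a × ((i : Fin n) → 1 ≤ a i × a i ≤ N)

primeCount : ℕ → ℕ
primeCount x = length (filter prime? (upTo (suc x)))

primeCountSqrt : ℕ → ℕ
primeCountSqrt N = length (filter (λ p → prime? p ×-dec (p * p ≤? N)) (upTo (suc N)))

-- |P_□| : primes p with N^{1/3} < p ≤ N^{1/2} (i.e. N < p³ and p² ≤ N)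
-- such that p² ∣ a for some a ∈ A
squarePrimeCount : ℕ → ∀ {n} → (Fin n → ℕ) → ℕ
squarePrimeCount N a =
  length (filter (λ p → prime? p ×-dec ((N <? p * p * p) ×-dec ((p * p ≤? N)
                   ×-dec any? (λ i → (p * p) ∣? a i))))
                 (upTo (suc N)))

{-# OPTIONS --safe #-}
module Submission where

-- Let t = ⌊N^(1/12)⌋, T ≈ t⁴ > N^(1/3) and T′ ≈ t⁶ > N^(1/2). Each a ∈ A is x · y · u with x, y equal to 1 or to primes > T and u a
-- product of primes ≤ T; so A is the edge set of a multigraph on {1} ∪ {primes > T}, every edge of which has an end ≤ √N. Call two
-- disjoint sets of edges with the same product of ends an exchange. Choosing a side in each of m disjoint exchanges gives 2^m products
-- that differ only in their T-smooth parts, hence m ≤ T · O(log N). The same count with T′ in place of T bounds the number of disjoint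
-- pairs with equal x, so all but O(T′ log N) edges are pendant, each with a prime x > T′ of its own.
-- From the other edges remove exchanges of O(t log N) edges greedily; they account for t · T · O(log² N) edges. Grow balls of radius
-- t · O(log N) in what remains, cutting at most a fraction 1/t of the edges. In a ball with a spanning tree, an extra edge closing an
-- even cycle is an exchange, and so are the edges of two odd cycles through a common vertex once the tree paths are cancelled. Hence
-- all extra edges close odd cycles, and these are disjoint. As no edge joins two primes > √N, an odd cycle has two adjacent vertices
-- ≤ √N, or is a loop at a prime whose square divides an element of A: there are at most (π(√N) + |P_□|)/2 of them, up to O(1).

open import Defs
open import Data.Nat using (ℕ; _+_; _*_; _∸_; _^_; _≤_)
open import Data.Fin using (Fin)
open import Data.Product using (Σ)

open import Data.Bool using (Bool; true; false; not; _xor_; if_then_else_)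
import Data.Bool.Properties as Bool
open import Data.Empty using (⊥; ⊥-elim)
open import Data.Fin using (toℕ; fromℕ<; combine; funToFin; finToFun) renaming (zero to fzero; suc to fsuc)
import Data.Fin.Properties as Fin
open import Data.Fin.Subset using (Subset)
open import Data.List using (List; []; _∷_; _++_; length; map; filter; concatMap; allFin; upTo)
import Data.List.Membership.DecPropositional as DecMembership
open import Data.List.Membership.Propositional using (_∈_; _∉_; find; lose)
open import Data.List.Membership.Propositional.Properties
  using (∈-++⁺ˡ; ∈-++⁺ʳ; ∈-++⁻; ∈-∃++; ∈-filter⁺; ∈-filter⁻; ∈-length; ∈-allFin; ∈-map⁺; ∈-map⁻; ∈-upTo⁺; ∈-upTo⁻)
open import Data.List.Properties
  using (length-++; map-++; map-cong; length-map; length-filter; filter-notAll; length-tabulate; length-upTo)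
open import Data.List.Relation.Binary.Permutation.Propositional
  using (_↭_; ↭-refl; ↭-sym; ↭-trans; ↭-prep; ↭-reflexive; ↭⇒↭ₛ)
open import Data.List.Relation.Binary.Permutation.Propositional.Properties
  using (shift; ∈-resp-↭; ↭-length; ++⁺ˡ) renaming (map⁺ to ↭-map⁺)
import Data.List.Relation.Binary.Permutation.Setoid.Properties as Permutation
open import Data.List.Relation.Binary.Subset.Propositional using (_⊆_)
open import Data.List.Relation.Unary.All as All using (All; []; _∷_)
open import Data.List.Relation.Unary.All.Properties using (¬Any⇒All¬)
open import Data.List.Relation.Unary.AllPairs as AllPairs using ([]; _∷_)
open import Data.List.Relation.Unary.Any as Any using (here; there)
open import Data.List.Relation.Unary.Unique.Propositional using (Unique)
import Data.List.Relation.Unary.Unique.Propositional.Properties as Unique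
open import Data.List.Relation.Unary.Unique.Propositional.Properties using (Unique[x∷xs]⇒x∉xs)
open import Data.Nat
  using (zero; suc; _<_; z≤n; s≤s; _≟_; _/_; _%_; NonZero; >-nonZero; ≢-nonZero; nonTrivial⇒n>1)
open import Data.Nat.DivMod using (m≡m%n+[m/n]*n; m%n<n; m/n*n≤m)
open import Data.Nat.Divisibility using (_∣_; _∣?_; divides; ∣⇒≤)
open import Data.Nat.ListAction using (sum; product)
open import Data.Nat.ListAction.Properties using (sum-↭; sum-++; product-++)
open import Data.Nat.Primality using (Prime; prime?; ¬prime[1]; prime⇒nonTrivial)
open import Data.Nat.Primality.Factorisation using (PrimeFactorisation; factorise)
open import Data.Nat.Properties hiding (_≟_)
open import Data.Nat.Tactic.RingSolver using (solve-∀)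
open import Data.Product using (∃₂; _×_; _,_; proj₁; proj₂; ∃-syntax; swap)
open import Data.Sum as Sum using (_⊎_; inj₁; inj₂; [_,_]′)
import Data.Vec as Vec
open import Data.Vec using (_[_]≔_; []; _∷_)
import Data.Vec.Properties as Vec
open import Function using (_∘_; id)
open import Relation.Binary.Definitions using (DecidableEquality)
open import Relation.Binary.PropositionalEquality hiding ([_])
open import Relation.Nullary using (¬_; ¬?; Dec; yes; no; does)
open import Relation.Nullary.Decidable using (_×-dec_; _⊎-dec_; map′; dec-true; dec-false)
open import Relation.Unary using (Decidable)
open import Algebra.Properties.CommutativeSemigroup *-commutativeSemigroup
  using (x∙yz≈y∙xz) renaming (interchange to *-interchange)
open import Algebra.Properties.CommutativeSemigroup +-commutativeSemigroup
  using () renaming (x∙yz≈y∙xz to +x∙yz≈y∙xz; interchange to +-interchange)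
open DecMembership _≟_ using () renaming (_∈?_ to _∈ℕ?_)

-- The exponent 5/12 is a balance. An exchange costs the edges that it removes, about t log N of
-- them, and up to about T log N exchanges may occur; cutting costs a t-th of the edges present,
-- about T′ log N / t. Up to logarithms these costs are t N^(1/3) and N^(1/2) / t, which agree at t
-- = N^(1/12). For this the pendant edges have to go first: A may have about N / log N elements, and
-- losing a t-th of them would be far too much. A pendant edge is paid for by its own prime, which
-- no other edge uses. The remaining primes above T and the vertex 1 pay for one tree edge each,
-- which completes π(N). An extra edge is charged to two units of weight on its cycle, whence the
-- halves in the statement; all inequalities are doubled to stay within ℕ. Tree paths to the root
-- overlap, so the two sides of a closed walk are lists with repetitions. The work on multiplicities
-- shows that after cancellation every edge is left at most once, as a subset product demands.

-- Sums and products over lists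

sumOver prodOver : ∀ {A : Set} → (A → ℕ) → List A → ℕ
sumOver  f l = sum (map f l)
prodOver f l = product (map f l)

module _ {A : Set} where

  sumOver-++ : ∀ (f : A → ℕ) l m → sumOver f (l ++ m) ≡ sumOver f l + sumOver f m
  sumOver-++ f l m = trans (cong sum (map-++ f l m)) (sum-++ (map f l) (map f m))

  prodOver-++ : ∀ (f : A → ℕ) l m → prodOver f (l ++ m) ≡ prodOver f l * prodOver f m
  prodOver-++ f l m = trans (cong product (map-++ f l m)) (product-++ (map f l) (map f m))

  sumOver-↭ : ∀ (f : A → ℕ) {l m} → l ↭ m → sumOver f l ≡ sumOver f m
  sumOver-↭ f p = sum-↭ (↭-map⁺ f p)

  prodOver-* : ∀ (f g : A → ℕ) l → prodOver (λ a → f a * g a) l ≡ prodOver f l * prodOver g l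
  prodOver-* f g [] = refl
  prodOver-* f g (a ∷ l) rewrite prodOver-* f g l = *-interchange (f a) (g a) (prodOver f l) (prodOver g l)

  prodOver>0 : ∀ {f : A → ℕ} → (∀ a → 1 ≤ f a) → ∀ l → 1 ≤ prodOver f l
  prodOver>0 f>0 [] = ≤-refl
  prodOver>0 f>0 (a ∷ l) = *-mono-≤ (f>0 a) (prodOver>0 f>0 l)

  sumOver-1 : ∀ (l : List A) → sumOver (λ _ → 1) l ≡ length l
  sumOver-1 [] = refl
  sumOver-1 (a ∷ l) = cong suc (sumOver-1 l)

  sumOver-+ : ∀ (f g : A → ℕ) l → sumOver (λ a → f a + g a) l ≡ sumOver f l + sumOver g l
  sumOver-+ f g [] = refl
  sumOver-+ f g (a ∷ l) rewrite sumOver-+ f g l = +-interchange (f a) (g a) (sumOver f l) (sumOver g l)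

  sumOver-2+ : ∀ (f : A → ℕ) l → sumOver (λ a → 2 + f a) l ≡ 2 * length l + sumOver f l
  sumOver-2+ f [] = refl
  sumOver-2+ f (a ∷ l) rewrite sumOver-2+ f l = arith (f a) (length l) (sumOver f l)
    where
    arith : ∀ p q s → 2 + p + (2 * q + s) ≡ 2 * suc q + (p + s)
    arith = solve-∀

  unique-∷ : ∀ {a : A} {l} → a ∉ l → Unique l → Unique (a ∷ l)
  unique-∷ a∉l u = ¬Any⇒All¬ _ a∉l ∷ u

  unique-resp-↭ : ∀ {l m : List A} → l ↭ m → Unique l → Unique m
  unique-resp-↭ p = Permutation.Unique-resp-↭ (setoid A) (↭⇒↭ₛ p)

  ∈-shrink : ∀ {a b : A} l {m} → a ∈ l ++ b ∷ m → a ≢ b → a ∈ l ++ m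
  ∈-shrink l a∈ a≢b with ∈-++⁻ l a∈
  ... | inj₁ a∈l = ∈-++⁺ˡ a∈l
  ... | inj₂ (here a≡b) = ⊥-elim (a≢b a≡b)
  ... | inj₂ (there a∈m) = ∈-++⁺ʳ l a∈m

  ∈-expand : ∀ {a b : A} l {m} → a ∈ l ++ m → a ∈ l ++ b ∷ m
  ∈-expand l a∈ = ∈-resp-↭ (↭-sym (shift _ l _)) (there a∈)

  sumOver-⊆ : ∀ (f : A → ℕ) {l m} → Unique l → l ⊆ m → sumOver f l ≤ sumOver f m
  sumOver-⊆ f {[]} u l⊆m = z≤n
  sumOver-⊆ f {a ∷ l} (a∉l ∷ u) l⊆m with ∈-∃++ (l⊆m (here refl))
  ... | m₁ , m₂ , refl = ≤-trans
    (+-monoʳ-≤ (f a) (sumOver-⊆ f u λ b∈l → ∈-shrink m₁ (l⊆m (there b∈l)) λ b≡a → All.lookup a∉l b∈l (sym b≡a)))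
    (≤-reflexive (sym (sumOver-↭ f (shift a m₁ m₂))))

  length-⊆ : ∀ {l m : List A} → Unique l → l ⊆ m → length l ≤ length m
  length-⊆ {l} {m} u l⊆m = subst₂ _≤_ (sumOver-1 l) (sumOver-1 m) (sumOver-⊆ (λ _ → 1) u l⊆m)

  unique-++⁻ : ∀ (l {m} : List A) → Unique (l ++ m) → Unique l × Unique m × (∀ {a} → a ∈ l → a ∉ m)
  unique-++⁻ [] u = [] , u , λ ()
  unique-++⁻ (a ∷ l) {m} u@(_ ∷ u′) with unique-++⁻ l u′
  ... | ul , um , disj = unique-∷ (a∉ ∘ ∈-++⁺ˡ) ul , um , λ { (here refl) b∈m → a∉ (∈-++⁺ʳ l b∈m) ; (there b∈l) → disj b∈l }
    where
    a∉ : a ∉ l ++ m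
    a∉ = Unique[x∷xs]⇒x∉xs u

  module _ {P : A → Set} (P? : Decidable P) where

    length-filter-+ : ∀ l → length (filter P? l) + length (filter (λ a → ¬? (P? a)) l) ≡ length l
    length-filter-+ [] = refl
    length-filter-+ (a ∷ l) with does (P? a)
    ... | true = cong suc (length-filter-+ l)
    ... | false = trans (+-suc _ _) (cong suc (length-filter-+ l))

-- Multiplicities and cancellation

module Multiplicity {A : Set} (_≟_ : DecidableEquality A) where

  open DecMembership _≟_ using (_∈?_)

  count : A → List A → ℕ
  count a [] = 0
  count a (b ∷ l) with a ≟ b
  ... | yes _ = suc (count a l)
  ... | no _ = count a l

  count-++ : ∀ a l m → count a (l ++ m) ≡ count a l + count a m
  count-++ a [] m = refl
  count-++ a (b ∷ l) m with a ≟ b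
  ... | yes _ = cong suc (count-++ a l m)
  ... | no _ = count-++ a l m

  count-head : ∀ a l → count a (a ∷ l) ≡ suc (count a l)
  count-head a l with a ≟ a
  ... | yes _ = refl
  ... | no a≢a = ⊥-elim (a≢a refl)

  count-tail : ∀ {a b} l → a ≢ b → count a (b ∷ l) ≡ count a l
  count-tail {a} {b} l a≢b with a ≟ b
  ... | yes a≡b = ⊥-elim (a≢b a≡b)
  ... | no _ = refl

  ∉⇒count≡0 : ∀ {a l} → a ∉ l → count a l ≡ 0
  ∉⇒count≡0 {l = []} _ = refl
  ∉⇒count≡0 {l = b ∷ l} a∉ = trans (count-tail l (a∉ ∘ here)) (∉⇒count≡0 (a∉ ∘ there))

  count≡0⇒∉ : ∀ {a l} → count a l ≡ 0 → a ∉ l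
  count≡0⇒∉ {a} c≡0 (here {xs = l} refl) with () ← trans (sym (count-head a l)) c≡0
  count≡0⇒∉ {a} c≡0 (there {x = b} {xs = l} a∈l) with a ≟ b
  ... | no _ = count≡0⇒∉ c≡0 a∈l

  count>0⇒∈ : ∀ {a l} → 1 ≤ count a l → a ∈ l
  count>0⇒∈ {a} {b ∷ l} c with a ≟ b
  ... | yes a≡b = here a≡b
  ... | no _ = there (count>0⇒∈ c)

  count-≤1⇒unique : ∀ l → (∀ a → count a l ≤ 1) → Unique l
  count-≤1⇒unique [] _ = []
  count-≤1⇒unique (b ∷ l) c = unique-∷
    (count≡0⇒∉ (n≤0⇒n≡0 (≤-pred (subst (_≤ 1) (count-head b l) (c b)))))
    (count-≤1⇒unique l λ a → ≤-trans (count-∷ a) (c a))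
    where
    count-∷ : ∀ a → count a l ≤ count a (b ∷ l)
    count-∷ a with a ≟ b
    ... | yes _ = n≤1+n _
    ... | no _ = ≤-refl

  count-middle : ∀ a l b m → count a (l ++ b ∷ m) ≡ count a (b ∷ l ++ m)
  count-middle a l b m = begin
    count a (l ++ b ∷ m)                        ≡⟨ count-++ a l (b ∷ m) ⟩
    count a l + count a (b ∷ m)                 ≡⟨ cong (count a l +_) (count-++ a (b ∷ []) m) ⟩
    count a l + (count a (b ∷ []) + count a m)  ≡⟨ +x∙yz≈y∙xz (count a l) (count a (b ∷ [])) (count a m) ⟩
    count a (b ∷ []) + (count a l + count a m)  ≡⟨ cong (count a (b ∷ []) +_) (count-++ a l m) ⟨
    count a (b ∷ []) + count a (l ++ m)         ≡⟨ count-++ a (b ∷ []) (l ++ m) ⟨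
    count a (b ∷ l ++ m)                        ∎
    where open ≡-Reasoning

  -- The condition under which cancellation ends without repetitions: once common occurrences are
  -- struck out, each element is left at most once, and on one side only.
  Near : List A → List A → Set
  Near l m = ∀ a → count a l ≤ suc (count a m) × count a m ≤ suc (count a l)

  -- `balanced` says that cancellation preserves the ratio of the two products, cross-multiplied to
  -- avoid division. `kept` later shows that something is left.
  record Reduced (w : A → ℕ) (l m : List A) : Set where
    field
      S T      : List A
      unique   : Unique (S ++ T)
      S⊆       : S ⊆ l
      T⊆       : T ⊆ m
      short    : length S + length T ≤ length l + length m
      balanced : prodOver w l * prodOver w T ≡ prodOver w m * prodOver w S
      kept     : ∀ {a} → count a l ≢ count a m → a ∈ S ++ T

  -- A head of `l` that occurs in `m` is struck out of both. Otherwise `Near` allows it only one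
  -- occurrence in `l`, so it can join `S` without repetition.
  reduce : ∀ w l m → Near l m → Reduced w l m
  reduce w [] m near = record
    { S = [] ; T = m
    ; unique = count-≤1⇒unique m (proj₂ ∘ near)
    ; S⊆ = λ () ; T⊆ = id ; short = ≤-refl
    ; balanced = trans (*-identityˡ _) (sym (*-identityʳ _))
    ; kept = λ {a} ne → count>0⇒∈ (n≢0⇒n>0 (ne ∘ sym)) }
  reduce w (b ∷ l) m near with b ∈? m
  ... | yes b∈m with ∈-∃++ b∈m
  ...   | m₁ , m₂ , refl = record
    { S = S ; T = T ; unique = unique
    ; S⊆ = there ∘ S⊆ ; T⊆ = ∈-expand m₁ ∘ T⊆
    ; short = ≤-trans short (+-mono-≤ (n≤1+n _) (≤-trans (n≤1+n _) (≤-reflexive (↭-length (↭-sym (shift b m₁ m₂))))))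
    ; balanced = begin
        w b * prodOver w l * prodOver w T            ≡⟨ *-assoc (w b) _ _ ⟩
        w b * (prodOver w l * prodOver w T)          ≡⟨ cong (w b *_) balanced ⟩
        w b * (prodOver w (m₁ ++ m₂) * prodOver w S) ≡⟨ *-assoc (w b) _ _ ⟨
        w b * prodOver w (m₁ ++ m₂) * prodOver w S   ≡⟨ cong (_* prodOver w S) (sym middle) ⟩
        prodOver w (m₁ ++ b ∷ m₂) * prodOver w S     ∎
    ; kept = λ {a} ne → kept (ne ∘ count-both a) }
    where
    open ≡-Reasoning
    middle : prodOver w (m₁ ++ b ∷ m₂) ≡ w b * prodOver w (m₁ ++ m₂)
    middle = begin
      prodOver w (m₁ ++ b ∷ m₂)              ≡⟨ prodOver-++ w m₁ (b ∷ m₂) ⟩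
      prodOver w m₁ * (w b * prodOver w m₂)  ≡⟨ x∙yz≈y∙xz (prodOver w m₁) (w b) (prodOver w m₂) ⟩
      w b * (prodOver w m₁ * prodOver w m₂)  ≡⟨ cong (w b *_) (sym (prodOver-++ w m₁ m₂)) ⟩
      w b * prodOver w (m₁ ++ m₂)            ∎
    count-both : ∀ a → count a l ≡ count a (m₁ ++ m₂) → count a (b ∷ l) ≡ count a (m₁ ++ b ∷ m₂)
    count-both a eq rewrite count-middle a m₁ b m₂ with a ≟ b
    ... | yes _ = cong suc eq
    ... | no _ = eq
    near′ : Near l (m₁ ++ m₂)
    near′ a with near a
    ... | p , q rewrite count-middle a m₁ b m₂ with a ≟ b
    ...   | yes _ = ≤-pred p , ≤-pred q
    ...   | no _ = p , q
    open Reduced (reduce w l (m₁ ++ m₂) near′)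
  reduce w (b ∷ l) m near | no b∉m = record
    { S = b ∷ S ; T = T
    ; unique = unique-∷ ([ b∉l ∘ S⊆ , b∉m ∘ T⊆ ]′ ∘ ∈-++⁻ S) unique
    ; S⊆ = λ { (here eq) → here eq ; (there a∈S) → there (S⊆ a∈S) } ; T⊆ = T⊆
    ; short = s≤s short
    ; balanced = begin
        w b * prodOver w l * prodOver w T            ≡⟨ *-assoc (w b) _ _ ⟩
        w b * (prodOver w l * prodOver w T)          ≡⟨ cong (w b *_) balanced ⟩
        w b * (prodOver w m * prodOver w S)          ≡⟨ x∙yz≈y∙xz (w b) (prodOver w m) (prodOver w S) ⟩
        prodOver w m * (w b * prodOver w S)          ∎
    ; kept = kept′ }
    where
    open ≡-Reasoning
    b∉l : b ∉ l
    b∉l = count≡0⇒∉ (n≤0⇒n≡0 (≤-pred (subst₂ _≤_ (count-head b l) (cong suc (∉⇒count≡0 b∉m)) (proj₁ (near b)))))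
    near′ : Near l m
    near′ a with near a
    ... | p , q with a ≟ b
    ...   | yes refl rewrite ∉⇒count≡0 b∉l | ∉⇒count≡0 b∉m = z≤n , z≤n
    ...   | no _ = p , q
    open Reduced (reduce w l m near′)
    kept′ : ∀ {a} → count a (b ∷ l) ≢ count a m → a ∈ b ∷ S ++ T
    kept′ {a} ne with a ≟ b
    ... | yes a≡b = here a≡b
    ... | no _ = there (kept ne)

-- Exchanges

-- Disjointness of `S` and `T` is not a field: it follows from uniqueness of `supports`, which also
-- keeps different exchanges apart.
record Exchange {A : Set} (w : A → ℕ) : Set where
  field
    S T      : List A
    nonempty : ∃[ a ] a ∈ S ++ T
    balanced : prodOver w S ≡ prodOver w T

  support : List A
  support = S ++ T

supports : ∀ {A : Set} {w : A → ℕ} → List (Exchange w) → List A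
supports = concatMap Exchange.support

-- Trees and odd cycles

update : ∀ {B : Set} → (ℕ → B) → ℕ → B → ℕ → B
update f u b v with v ≟ u
... | yes _ = b
... | no _ = f v

update-new : ∀ {B : Set} (f : ℕ → B) u b → update f u b u ≡ b
update-new f u b with u ≟ u
... | yes _ = refl
... | no u≢u = ⊥-elim (u≢u refl)

update-old : ∀ {B : Set} (f : ℕ → B) {u v} b → v ≢ u → update f u b v ≡ f v
update-old f {u} {v} b v≢u with v ≟ u
... | yes v≡u = ⊥-elim (v≢u v≡u)
... | no _ = refl

module Graph {A : Set} (_≟ₑ_ : DecidableEquality A) (x y : A → ℕ)
             (x>0 : ∀ e → 1 ≤ x e) (y>0 : ∀ e → 1 ≤ y e) where

  open Multiplicity _≟ₑ_
  open DecMembership _≟ₑ_ using (_∈?_)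

  w : A → ℕ
  w e = x e * y e

  -- An exchange of bounded size inside `F`. It arises from a closed walk of even length whose edges
  -- are put alternately on the two sides.
  record Trail (L : ℕ) (F : List A) : Set where
    field
      S T      : List A
      unique   : Unique (S ++ T)
      ⊆edges   : S ++ T ⊆ F
      nonempty : ∃[ e ] e ∈ S ++ T
      short    : length (S ++ T) ≤ L
      balanced : prodOver w S ≡ prodOver w T

  -- Since the two products agree, their common value cancels from the ratio kept by `reduce`; an
  -- edge with different multiplicities on the two sides survives.
  trail : ∀ {L F} l m → Near l m → l ⊆ F → m ⊆ F → length l + length m ≤ L →
          prodOver w l ≡ prodOver w m → ∃[ e ] count e l ≢ count e m → Trail L F
  trail l m near l⊆F m⊆F short≤ w≡ (e , ne) = record
    { S = S ; T = T ; unique = unique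
    ; ⊆edges = [ l⊆F ∘ S⊆ , m⊆F ∘ T⊆ ]′ ∘ ∈-++⁻ S
    ; nonempty = e , kept ne
    ; short = subst (_≤ _) (sym (length-++ S)) (≤-trans short short≤)
    ; balanced = sym (*-cancelˡ-≡ _ _ (prodOver w l) {{>-nonZero (prodOver>0 (λ e → *-mono-≤ (x>0 e) (y>0 e)) l)}}
        (trans balanced (cong (_* prodOver w S) (sym w≡)))) }
    where open Reduced (reduce w l m near)

  Joins : A → ℕ → ℕ → Set
  Joins e u p = (x e ≡ u × y e ≡ p) ⊎ (x e ≡ p × y e ≡ u)

  joins-w : ∀ {e u p} → Joins e u p → w e ≡ u * p
  joins-w (inj₁ (refl , refl)) = refl
  joins-w {e} (inj₂ (refl , refl)) = *-comm (x e) (y e)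

  -- In a tree `q` is the parity of the parent, so the edge is listed under that of its lower end.
  -- In `chord` both ends of an odd extra edge have parity `q`, and the other list makes it
  -- alternate with the tree edges at its ends.
  extend : Bool → Bool → A → List A → List A
  extend b q e l = if b xor q then e ∷ l else l

  ∈-extend⁻ : ∀ b q {a e l} → a ∈ extend b q e l → (a ≡ e × b ≡ not q) ⊎ a ∈ l
  ∈-extend⁻ true false (here eq) = inj₁ (eq , refl)
  ∈-extend⁻ true false (there a∈) = inj₂ a∈
  ∈-extend⁻ false true (here eq) = inj₁ (eq , refl)
  ∈-extend⁻ false true (there a∈) = inj₂ a∈
  ∈-extend⁻ true true a∈ = inj₂ a∈
  ∈-extend⁻ false false a∈ = inj₂ a∈

  ∈-extend⁺ : ∀ b q {a e l} → a ∈ l → a ∈ extend b q e l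
  ∈-extend⁺ true false a∈ = there a∈
  ∈-extend⁺ false true a∈ = there a∈
  ∈-extend⁺ true true a∈ = a∈
  ∈-extend⁺ false false a∈ = a∈

  count-extend : ∀ b q {a e} l → a ≢ e → count a (extend b q e l) ≡ count a l
  count-extend true false l a≢e = count-tail l a≢e
  count-extend false true l a≢e = count-tail l a≢e
  count-extend true true l a≢e = refl
  count-extend false false l a≢e = refl

  count-extend-≤1 : ∀ b q {e} l → e ∉ l → count e (extend b q e l) ≤ 1
  count-extend-≤1 b q {e} l e∉l with b xor q
  ... | true = ≤-reflexive (trans (count-head e l) (cong suc (∉⇒count≡0 e∉l)))
  ... | false = ≤-trans (≤-reflexive (∉⇒count≡0 e∉l)) z≤n

  length-extend : ∀ q e l m → length (extend true q e l) + length (extend false q e m) ≡ suc (length l + length m)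
  length-extend true e l m = +-suc _ _
  length-extend false e l m = refl

  -- Growth is leaf by leaf. Each new edge ends at a vertex not seen before, hence is absent from
  -- all earlier edges and paths; the bounds on multiplicities rest on this.
  data Tree (F : List A) (r : ℕ) : List ℕ → Set where
    root  : Tree F r (r ∷ [])
    graft : ∀ {vs} (t : Tree F r vs) {u p e} → u ∉ vs → p ∈ vs → e ∈ F → Joins e u p → Tree F r (u ∷ vs)

  module _ {F : List A} {r : ℕ} where

    -- Like `path`, a total function with a default value off the tree; the lemmas speak only of
    -- vertices in `vs`.
    parity : ∀ {vs} → Tree F r vs → ℕ → Bool
    parity root = λ _ → false
    parity (graft t {u} {p} _ _ _ _) = update (parity t) u (not (parity t p))

    -- The tree edges whose lower endpoint has parity b.
    edges : ∀ {vs} → Tree F r vs → Bool → List A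
    edges root b = []
    edges (graft t {u} {p} {e} _ _ _ _) b = extend b (parity t p) e (edges t b)

    -- Those among them which lie on the way from a vertex to the root.
    path : ∀ {vs} → Tree F r vs → Bool → ℕ → List A
    path root b = λ _ → []
    path (graft t {u} {p} {e} _ _ _ _) b = update (path t b) u (extend b (parity t p) e (path t b p))

    depth : ∀ {vs} → Tree F r vs → ℕ → ℕ
    depth t v = length (path t true v) + length (path t false v)

    ∈∉⇒≢ : ∀ {u v} {vs : List ℕ} → v ∈ vs → u ∉ vs → v ≢ u
    ∈∉⇒≢ v∈ u∉ refl = u∉ v∈

    module _ {vs} (t : Tree F r vs) {u p e} (u∉ : u ∉ vs) (p∈ : p ∈ vs) (e∈ : e ∈ F) (j : Joins e u p) where
      private t⁺ = graft t u∉ p∈ e∈ j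

      path-new : ∀ b → path t⁺ b u ≡ extend b (parity t p) e (path t b p)
      path-new b = update-new (path t b) u _

      path-old : ∀ b {v} → v ∈ vs → path t⁺ b v ≡ path t b v
      path-old b v∈ = update-old (path t b) _ (∈∉⇒≢ v∈ u∉)

      parity-new : parity t⁺ u ≡ not (parity t p)
      parity-new = update-new (parity t) u _

      parity-old : ∀ {v} → v ∈ vs → parity t⁺ v ≡ parity t v
      parity-old v∈ = update-old (parity t) _ (∈∉⇒≢ v∈ u∉)

      depth-new : depth t⁺ u ≡ suc (depth t p)
      depth-new rewrite path-new true | path-new false = length-extend (parity t p) e _ _

      depth-old : ∀ {v} → v ∈ vs → depth t⁺ v ≡ depth t v
      depth-old v∈ = cong₂ (λ l m → length l + length m) (path-old true v∈) (path-old false v∈)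

    edges-ends : ∀ {vs} (t : Tree F r vs) b {a} → a ∈ edges t b → a ∈ F × x a ∈ vs × y a ∈ vs
    edges-ends (graft t {p = p} u∉ p∈ e∈ j) b a∈ with ∈-extend⁻ b (parity t p) a∈ | j
    ... | inj₁ (refl , _) | inj₁ (refl , refl) = e∈ , here refl , there p∈
    ... | inj₁ (refl , _) | inj₂ (refl , refl) = e∈ , there p∈ , here refl
    ... | inj₂ a∈t | _ with edges-ends t b a∈t
    ...   | a∈F , xa∈ , ya∈ = a∈F , there xa∈ , there ya∈

    new∉edges : ∀ {vs} (t : Tree F r vs) b {u p e} → u ∉ vs → Joins e u p → e ∉ edges t b
    new∉edges t b u∉ (inj₁ (refl , _)) e∈ = u∉ (proj₁ (proj₂ (edges-ends t b e∈)))
    new∉edges t b u∉ (inj₂ (_ , refl)) e∈ = u∉ (proj₂ (proj₂ (edges-ends t b e∈)))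

    path⊆edges : ∀ {vs} (t : Tree F r vs) b {v} → v ∈ vs → path t b v ⊆ edges t b
    path⊆edges root b _ ()
    path⊆edges (graft t {p = p} u∉ p∈ e∈ j) b (here refl) a∈
      rewrite path-new t u∉ p∈ e∈ j b with b xor parity t p
    ... | false = path⊆edges t b p∈ a∈
    ... | true with a∈
    ...   | here eq = here eq
    ...   | there a∈p = there (path⊆edges t b p∈ a∈p)
    path⊆edges (graft t {p = p} u∉ p∈ e∈ j) b (there v∈) a∈
      rewrite path-old t u∉ p∈ e∈ j b v∈ = ∈-extend⁺ b (parity t p) (path⊆edges t b v∈ a∈)

    new∉path : ∀ {vs} (t : Tree F r vs) b {u p e v} → u ∉ vs → Joins e u p → v ∈ vs → e ∉ path t b v
    new∉path t b u∉ j v∈ e∈ = new∉edges t b u∉ j (path⊆edges t b v∈ e∈)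

    edges-disjoint : ∀ {vs} (t : Tree F r vs) {a} → a ∈ edges t true → a ∉ edges t false
    edges-disjoint (graft t {p = p} u∉ p∈ e∈ j) a∈₁ a∈₀
      with ∈-extend⁻ true (parity t p) a∈₁ | ∈-extend⁻ false (parity t p) a∈₀
    ... | inj₁ (refl , eq) | inj₁ (_ , eq′) with () ← trans eq (sym eq′)
    ... | inj₁ (refl , _) | inj₂ a∈ = new∉edges t false u∉ j a∈
    ... | inj₂ a∈ | inj₁ (refl , _) = new∉edges t true u∉ j a∈
    ... | inj₂ a∈₁′ | inj₂ a∈₀′ = edges-disjoint t a∈₁′ a∈₀′

    length-edges : ∀ {vs} (t : Tree F r vs) → length (edges t true ++ edges t false) ≤ length vs
    length-edges {vs} t = subst (_≤ length vs) (sym (length-++ (edges t true))) (go t)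
      where
      go : ∀ {vs} (t : Tree F r vs) → length (edges t true) + length (edges t false) ≤ length vs
      go root = z≤n
      go (graft t {p = p} {e = e} _ _ _ _) = ≤-trans (≤-reflexive (length-extend (parity t p) e _ _)) (s≤s (go t))

    count-path-≤1 : ∀ {vs} (t : Tree F r vs) b {v} → v ∈ vs → ∀ a → count a (path t b v) ≤ 1
    count-path-≤1 root b _ a = z≤n
    count-path-≤1 (graft t {p = p} {e = e} u∉ p∈ e∈ j) b (here refl) a
      rewrite path-new t u∉ p∈ e∈ j b with a ≟ₑ e
    ... | yes refl = count-extend-≤1 b (parity t p) _ (new∉path t b u∉ j p∈)
    ... | no a≢e rewrite count-extend b (parity t p) (path t b p) a≢e = count-path-≤1 t b p∈ a
    count-path-≤1 (graft t u∉ p∈ e∈ j) b (there v∈) a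
      rewrite path-old t u∉ p∈ e∈ j b v∈ = count-path-≤1 t b v∈ a

    -- On a path to the root every inner vertex lies on one edge of each parity and cancels in the
    -- ratio of the two products. What remains is v times r if the length is odd and v over r if it
    -- is even, written without division.
    Alternates : Bool → ℕ → ℕ → ℕ → Set
    Alternates true  v odd even = odd ≡ v * r * even
    Alternates false v odd even = even * r ≡ v * odd

    alternates : ∀ {vs} (t : Tree F r vs) {v} → v ∈ vs →
                 Alternates (parity t v) v (prodOver w (path t true v)) (prodOver w (path t false v))
    alternates root (here refl) = trans (*-identityˡ r) (sym (*-identityʳ r))
    alternates (graft t {u} {p} {e} u∉ p∈ e∈ j) (here refl)
      rewrite parity-new t u∉ p∈ e∈ j | path-new t u∉ p∈ e∈ j true | path-new t u∉ p∈ e∈ j false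
      with parity t p | alternates t p∈
    ... | true | eq rewrite joins-w {e} j | eq = arith u p r (prodOver w (path t false p))
      where
      arith : ∀ u p r q → u * p * q * r ≡ u * (p * r * q)
      arith = solve-∀
    ... | false | eq rewrite joins-w {e} j = begin
        u * p * prodOver w (path t true p)     ≡⟨ *-assoc u p _ ⟩
        u * (p * prodOver w (path t true p))   ≡⟨ cong (u *_) (sym eq) ⟩
        u * (prodOver w (path t false p) * r)  ≡⟨ arith u (prodOver w (path t false p)) r ⟩
        u * r * prodOver w (path t false p)    ∎
      where
      open ≡-Reasoning
      arith : ∀ u q r → u * (q * r) ≡ u * r * q
      arith = solve-∀
    alternates (graft t u∉ p∈ e∈ j) (there v∈)
      rewrite parity-old t u∉ p∈ e∈ j v∈ | path-old t u∉ p∈ e∈ j true v∈ | path-old t u∉ p∈ e∈ j false v∈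
      = alternates t v∈

    -- v lies on the cycle which an extra edge between a and b closes in the tree.
    record OnCycle {vs} (t : Tree F r vs) (v a b : ℕ) : Set where
      constructor onCycle
      field
        vertex : v ∈ vs
        below  : (∀ s → path t s v ⊆ path t s a) ⊎ (∀ s → path t s v ⊆ path t s b)
        above  : ∀ s {e} → e ∈ path t s a → e ∈ path t s b → e ∈ path t s v

    onCycle-sym : ∀ {vs} {t : Tree F r vs} {v a b} → OnCycle t v a b → OnCycle t v b a
    onCycle-sym (onCycle v∈ bl ab) = onCycle v∈ (Sum.swap bl) λ s e∈b e∈a → ab s e∈a e∈b

    onCycle-left : ∀ {vs} {t : Tree F r vs} {a b} → a ∈ vs → OnCycle t a a b
    onCycle-left a∈ = onCycle a∈ (inj₁ λ s e∈ → e∈) λ s e∈a e∈b → e∈a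

    onCycle-right : ∀ {vs} {t : Tree F r vs} {a b} → b ∈ vs → OnCycle t b a b
    onCycle-right b∈ = onCycle b∈ (inj₂ λ s e∈ → e∈) λ s e∈a e∈b → e∈b

    module _ {vs} (t : Tree F r vs) {u p e} (u∉ : u ∉ vs) (p∈ : p ∈ vs) (e∈ : e ∈ F) (j : Joins e u p) where
      private t⁺ = graft t u∉ p∈ e∈ j

      path-parent⊆ : ∀ s → path t s p ⊆ path t⁺ s u
      path-parent⊆ s rewrite path-new t u∉ p∈ e∈ j s = ∈-extend⁺ s (parity t p)

      path-new∩old : ∀ s {b a} → b ∈ vs → a ∈ path t⁺ s u → a ∈ path t s b → a ∈ path t s p
      path-new∩old s b∈ a∈u a∈b rewrite path-new t u∉ p∈ e∈ j s with ∈-extend⁻ s (parity t p) a∈u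
      ... | inj₁ (refl , _) = ⊥-elim (new∉path t s u∉ j b∈ a∈b)
      ... | inj₂ a∈p = a∈p

      old⊆ : ∀ s {v} → v ∈ vs → path t s v ⊆ path t⁺ s v
      old⊆ s v∈ = subst (_ ∈_) (sym (path-old t u∉ p∈ e∈ j s v∈))

      ⊆old : ∀ s {v} → v ∈ vs → path t⁺ s v ⊆ path t s v
      ⊆old s v∈ = subst (_ ∈_) (path-old t u∉ p∈ e∈ j s v∈)

      onCycle-old : ∀ {v a b} → a ∈ vs → b ∈ vs → OnCycle t v a b → OnCycle t⁺ v a b
      onCycle-old a∈ b∈ (onCycle v∈ bl ab) = onCycle (there v∈)
        (Sum.map (λ h s → old⊆ s a∈ ∘ h s ∘ ⊆old s v∈) (λ h s → old⊆ s b∈ ∘ h s ∘ ⊆old s v∈) bl)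
        λ s e∈a e∈b → old⊆ s v∈ (ab s (⊆old s a∈ e∈a) (⊆old s b∈ e∈b))

      onCycle-new : ∀ {v b} → b ∈ vs → OnCycle t v p b → OnCycle t⁺ v u b
      onCycle-new b∈ (onCycle v∈ bl ab) = onCycle (there v∈)
        (Sum.map (λ h s → path-parent⊆ s ∘ h s ∘ ⊆old s v∈) (λ h s → old⊆ s b∈ ∘ h s ∘ ⊆old s v∈) bl)
        λ s e∈a e∈b → old⊆ s v∈ (ab s (path-new∩old s b∈ e∈a (⊆old s b∈ e∈b)) (⊆old s b∈ e∈b))

    -- Small vertices on cycles

    module _ (small : ℕ → Bool) (small-end : ∀ e → small (x e) ≡ true ⊎ small (y e) ≡ true) where

      record SmallPair {vs} (t : Tree F r vs) (a b : ℕ) : Set where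
        constructor smallPair
        field
          {g h}     : ℕ
          g≢h       : g ≢ h
          g-small   : small g ≡ true
          h-small   : small h ≡ true
          g-onCycle : OnCycle t g a b
          h-onCycle : OnCycle t h a b

      smallPair-sym : ∀ {vs} {t : Tree F r vs} {a b} → SmallPair t a b → SmallPair t b a
      smallPair-sym (smallPair ne sg sh og oh) = smallPair ne sg sh (onCycle-sym og) (onCycle-sym oh)

      -- Constant along tree edges with exactly one small end.
      class : ∀ {vs} → Tree F r vs → ℕ → Bool
      class t v = parity t v xor small v

      joins-small : ∀ {e u p} → Joins e u p → (small u ≡ true × small p ≡ true) ⊎ small u ≡ not (small p)
      joins-small {e} {u} {p} j with small u in su | small p in sp
      ... | true | true = inj₁ (refl , refl)
      ... | true | false = inj₂ refl
      ... | false | true = inj₂ refl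
      ... | false | false with j | small-end e
      ...   | inj₁ (refl , refl) | inj₁ sx with () ← trans (sym su) sx
      ...   | inj₁ (refl , refl) | inj₂ sy with () ← trans (sym sp) sy
      ...   | inj₂ (refl , refl) | inj₁ sx with () ← trans (sym sp) sx
      ...   | inj₂ (refl , refl) | inj₂ sy with () ← trans (sym su) sy

      -- Where small and large vertices alternate along the tree, `class` is constant. Different
      -- classes at `a` and `b` therefore force an edge with two small ends between them. The
      -- recursion replaces the newest vertex by its parent until such an edge is met.
      findPair : ∀ {vs} (t : Tree F r vs) {a b} → a ∈ vs → b ∈ vs → class t a ≢ class t b → SmallPair t a b
      findNew : ∀ {vs} (t : Tree F r vs) {u p e b} (u∉ : u ∉ vs) (p∈ : p ∈ vs) (e∈ : e ∈ F) (j : Joins e u p) →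
                b ∈ vs → class (graft t u∉ p∈ e∈ j) u ≢ class t b → SmallPair (graft t u∉ p∈ e∈ j) u b
      findPair root (here refl) (here refl) ne = ⊥-elim (ne refl)
      findPair (graft t u∉ p∈ e∈ j) (here refl) (here refl) ne = ⊥-elim (ne refl)
      findPair (graft t u∉ p∈ e∈ j) (here refl) (there b∈) ne =
        findNew t u∉ p∈ e∈ j b∈ (ne ∘ λ eq → trans eq (cong (_xor _) (sym (parity-old t u∉ p∈ e∈ j b∈))))
      findPair (graft t u∉ p∈ e∈ j) (there a∈) (here refl) ne = smallPair-sym
        (findNew t u∉ p∈ e∈ j a∈ (ne ∘ λ eq → trans (cong (_xor _) (parity-old t u∉ p∈ e∈ j a∈)) (sym eq)))
      findPair (graft t u∉ p∈ e∈ j) (there a∈) (there b∈) ne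
        with findPair t a∈ b∈ (ne ∘ λ eq → trans (cong (_xor _) (parity-old t u∉ p∈ e∈ j a∈))
                                            (trans eq (cong (_xor _) (sym (parity-old t u∉ p∈ e∈ j b∈)))))
      ... | smallPair g≢h sg sh og oh = smallPair g≢h sg sh
        (onCycle-old t u∉ p∈ e∈ j a∈ b∈ og) (onCycle-old t u∉ p∈ e∈ j a∈ b∈ oh)
      findNew t {u} {p} {e} {b} u∉ p∈ e∈ j b∈ ne with joins-small {e} j
      ... | inj₁ (su , sp) = smallPair (∈∉⇒≢ p∈ u∉ ∘ sym) su sp (onCycle-left (here refl))
              (onCycle-new t u∉ p∈ e∈ j b∈ (onCycle-left p∈))
      ... | inj₂ flip with findPair t p∈ b∈ (ne ∘ trans same)
        where
        same : class (graft t u∉ p∈ e∈ j) u ≡ class t p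
        same rewrite parity-new t u∉ p∈ e∈ j | flip = not-xor-not (parity t p) (small p)
          where
          not-xor-not : ∀ q s → not q xor not s ≡ q xor s
          not-xor-not true s = refl
          not-xor-not false s = Bool.not-involutive s
      ... | smallPair g≢h sg sh og oh = smallPair g≢h sg sh (onCycle-new t u∉ p∈ e∈ j b∈ og) (onCycle-new t u∉ p∈ e∈ j b∈ oh)

    -- The tree edges of the cycle closed by e, split by parity, together with e itself.
    chord : ∀ {vs} → Tree F r vs → Bool → A → List A
    chord t b e = extend b (parity t (x e)) e (path t b (x e) ++ path t b (y e))

    module _ {vs} (t : Tree F r vs) where

      path⊆F : ∀ b {v} → v ∈ vs → path t b v ⊆ F
      path⊆F b v∈ e∈ = proj₁ (edges-ends t b (path⊆edges t b v∈ e∈))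

      record Extra (e : A) : Set where
        constructor extra
        field
          ∈edges : e ∈ F
          x∈     : x e ∈ vs
          y∈     : y e ∈ vs
          ∉edges : ∀ b → e ∉ edges t b

      open Extra

      extra∉path : ∀ {e} → Extra e → ∀ b {v} → v ∈ vs → e ∉ path t b v
      extra∉path h b v∈ e∈ = ∉edges h b (path⊆edges t b v∈ e∈)

      chord⊆F : ∀ {e} → Extra e → ∀ b → chord t b e ⊆ F
      chord⊆F {e} h b a∈ with ∈-extend⁻ b (parity t (x e)) a∈
      ... | inj₁ (refl , _) = ∈edges h
      ... | inj₂ a∈′ = [ path⊆F b (x∈ h) , path⊆F b (y∈ h) ]′ (∈-++⁻ (path t b (x e)) a∈′)

      length-chord : ∀ {d} → (∀ {v} → v ∈ vs → depth t v ≤ d) → ∀ {e} → Extra e →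
                     length (chord t true e) + length (chord t false e) ≤ suc (d + d)
      length-chord {d} deep {e} h = begin
        length (chord t true e) + length (chord t false e)  ≡⟨ length-extend (parity t (x e)) e _ _ ⟩
        suc (length (path t true (x e) ++ path t true (y e)) + length (path t false (x e) ++ path t false (y e)))
          ≡⟨ cong suc (cong₂ _+_ (length-++ (path t true (x e))) (length-++ (path t false (x e)))) ⟩
        suc (l₁ + m₁ + (l₀ + m₀))                           ≡⟨ cong suc (+-interchange l₁ m₁ l₀ m₀) ⟩
        suc (depth t (x e) + depth t (y e))                 ≤⟨ s≤s (+-mono-≤ (deep (x∈ h)) (deep (y∈ h))) ⟩
        suc (d + d)                                         ∎
        where
        open ≤-Reasoning
        l₁ = length (path t true (x e))
        l₀ = length (path t false (x e))
        m₁ = length (path t true (y e))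
        m₀ = length (path t false (y e))

      -- The alternating sum around an odd cycle leaves only the root, with coefficient two.
      chord-defect : ∀ {e} → Extra e → parity t (x e) ≡ parity t (y e) →
                     prodOver w (chord t true e) ≡ r * r * prodOver w (chord t false e)
      chord-defect {e} h same with parity t (x e) | parity t (y e) | alternates t (x∈ h) | alternates t (y∈ h)
      chord-defect {e} h refl | true | true | eqx | eqy
        rewrite prodOver-++ w (path t true (x e)) (path t true (y e))
              | prodOver-++ w (path t false (x e)) (path t false (y e)) | eqx | eqy
        = arith (x e) (y e) r (prodOver w (path t false (x e))) (prodOver w (path t false (y e)))
        where
        arith : ∀ a b r p q → a * r * p * (b * r * q) ≡ r * r * (a * b * (p * q))
        arith = solve-∀
      chord-defect {e} h refl | false | false | eqx | eqy
        rewrite prodOver-++ w (path t true (x e)) (path t true (y e))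
              | prodOver-++ w (path t false (x e)) (path t false (y e))
        = trans (arith₁ (x e) (y e) (prodOver w (path t true (x e))) (prodOver w (path t true (y e))))
            (trans (sym (cong₂ _*_ eqx eqy)) (arith₂ (prodOver w (path t false (x e))) (prodOver w (path t false (y e))) r))
        where
        arith₁ : ∀ a b p q → a * b * (p * q) ≡ a * p * (b * q)
        arith₁ = solve-∀
        arith₂ : ∀ p q r → p * r * (q * r) ≡ r * r * (p * q)
        arith₂ = solve-∀

      -- Tree edges have a definite parity, so one of the two path lists never contains e.
      one-sided : ∀ e → (∀ {v} → v ∈ vs → count e (path t true v) ≡ 0) ⊎ (∀ {v} → v ∈ vs → count e (path t false v) ≡ 0)
      one-sided e with e ∈? edges t true
      ... | yes e∈ = inj₂ λ v∈ → ∉⇒count≡0 (edges-disjoint t e∈ ∘ path⊆edges t false v∈)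
      ... | no e∉ = inj₁ λ v∈ → ∉⇒count≡0 (e∉ ∘ path⊆edges t true v∈)

      -- By `alternates` the path from the even end contributes a over r and the path from the odd
      -- end b times r. The root cancels, and the rest is a times b, the weight of `e`.
      evenTrail : ∀ {d L} → (∀ {v} → v ∈ vs → depth t v ≤ d) → suc (d + d) ≤ L →
                  ∀ {e a b} → e ∈ F → Joins e a b → a ∈ vs → b ∈ vs → (∀ s → e ∉ edges t s) →
                  parity t a ≡ false → parity t b ≡ true → Trail L F
      evenTrail {d} {L} deep bound {e} {a} {b} e∈ j a∈ b∈ e∉ pa pb =
        trail l m near l⊆ m⊆ (≤-trans short bound) balance (e , λ eq → 0≢1+n (trans (sym m-e) (trans (sym eq) l-e)))
        where
        P : Bool → ℕ → List A
        P = path t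
        l = e ∷ P true a ++ P false b
        m = P false a ++ P true b
        e∉path : ∀ s {v} → v ∈ vs → e ∉ P s v
        e∉path s v∈ = e∉ s ∘ path⊆edges t s v∈
        m-e : count e m ≡ 0
        m-e = trans (count-++ e (P false a) _) (cong₂ _+_ (∉⇒count≡0 (e∉path false a∈)) (∉⇒count≡0 (e∉path true b∈)))
        l-e : count e l ≡ 1
        l-e = trans (count-head e _) (cong suc (trans (count-++ e (P true a) _)
                (cong₂ _+_ (∉⇒count≡0 (e∉path true a∈)) (∉⇒count≡0 (e∉path false b∈)))))
        -- Paths of one parity from `a` and from `b` are on opposite sides, so a tree edge above
        -- both ends occurs once on each.
        near : Near l m
        near f with f ≟ₑ e
        ... | yes refl rewrite m-e | count-++ e (P true a) (P false b)
                             | ∉⇒count≡0 (e∉path true a∈) | ∉⇒count≡0 (e∉path false b∈) = ≤-refl , z≤n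
        ... | no _ rewrite count-++ f (P true a) (P false b) | count-++ f (P false a) (P true b) with one-sided f
        ...   | inj₁ zero₁ rewrite zero₁ a∈ | zero₁ b∈ | +-identityʳ (count f (P false a)) =
                  ≤-trans (count-path-≤1 t false b∈ f) (s≤s z≤n) , ≤-trans (count-path-≤1 t false a∈ f) (s≤s z≤n)
        ...   | inj₂ zero₀ rewrite zero₀ a∈ | zero₀ b∈ | +-identityʳ (count f (P true a)) =
                  ≤-trans (count-path-≤1 t true a∈ f) (s≤s z≤n) , ≤-trans (count-path-≤1 t true b∈ f) (s≤s z≤n)
        l⊆ : l ⊆ F
        l⊆ (here refl) = e∈
        l⊆ (there f∈) = [ path⊆F true a∈ , path⊆F false b∈ ]′ (∈-++⁻ (P true a) f∈)
        m⊆ : m ⊆ F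
        m⊆ f∈ = [ path⊆F false a∈ , path⊆F true b∈ ]′ (∈-++⁻ (P false a) f∈)
        short : length l + length m ≤ suc (d + d)
        short rewrite length-++ (P true a) {P false b} | length-++ (P false a) {P true b} =
          s≤s (≤-trans (≤-reflexive (arith (length (P true a)) (length (P false b)) (length (P false a)) (length (P true b))))
                       (+-mono-≤ (deep a∈) (deep b∈)))
          where
          arith : ∀ p q r s → p + q + (r + s) ≡ p + r + (s + q)
          arith = solve-∀
        balance : prodOver w l ≡ prodOver w m
        balance = begin
          w e * prodOver w (P true a ++ P false b)                 ≡⟨ cong₂ _*_ (joins-w {e} j) (prodOver-++ w (P true a) _) ⟩
          a * b * (prodOver w (P true a) * prodOver w (P false b)) ≡⟨ arith₁ a b (prodOver w (P true a)) _ ⟩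
          a * prodOver w (P true a) * (b * prodOver w (P false b)) ≡⟨ cong (_* (b * prodOver w (P false b))) eqa ⟨
          prodOver w (P false a) * r * (b * prodOver w (P false b)) ≡⟨ arith₂ (prodOver w (P false a)) r b _ ⟩
          prodOver w (P false a) * (b * r * prodOver w (P false b)) ≡⟨ cong (prodOver w (P false a) *_) eqb ⟨
          prodOver w (P false a) * prodOver w (P true b)           ≡⟨ prodOver-++ w (P false a) _ ⟨
          prodOver w (P false a ++ P true b)                       ∎
          where
          open ≡-Reasoning
          arith₁ : ∀ a b p q → a * b * (p * q) ≡ a * p * (b * q)
          arith₁ = solve-∀
          arith₂ : ∀ p r b q → p * r * (b * q) ≡ p * (b * r * q)
          arith₂ = solve-∀
          eqa = subst (λ q → Alternates q a (prodOver w (P true a)) (prodOver w (P false a))) pa (alternates t a∈)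
          eqb = subst (λ q → Alternates q b (prodOver w (P true b)) (prodOver w (P false b))) pb (alternates t b∈)

      -- Two odd cycles through a common vertex combine: their defects at the root cancel, and tree edges
      -- above one cycle also lie above the other, so no coefficient exceeds one in absolute value.
      oddTrail : ∀ {d L} → (∀ {v} → v ∈ vs → depth t v ≤ d) → suc (d + d) + suc (d + d) ≤ L →
                 ∀ {e f} → e ≢ f → Extra e → Extra f →
                 parity t (x e) ≡ parity t (y e) → parity t (x f) ≡ parity t (y f) →
                 ∀ {v} → OnCycle t v (x e) (y e) → OnCycle t v (x f) (y f) → Trail L F
      oddTrail {d} {L} deep bound {e} {f} e≢f he hf pe pf {v} oe of = trail l m near l⊆ m⊆ (≤-trans short bound) balance (e , differ)
        where
        C : Bool → A → List A
        C = chord t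
        P : Bool → ℕ → List A
        P = path t
        -- The chords are combined crosswise, so that each side receives one factor r * r from
        -- `chord-defect`.
        l = C true e ++ C false f
        m = C false e ++ C true f
        l⊆ : l ⊆ F
        l⊆ = [ chord⊆F he true , chord⊆F hf false ]′ ∘ ∈-++⁻ (C true e)
        m⊆ : m ⊆ F
        m⊆ = [ chord⊆F he false , chord⊆F hf true ]′ ∘ ∈-++⁻ (C false e)
        short : length l + length m ≤ suc (d + d) + suc (d + d)
        short rewrite length-++ (C true e) {C false f} | length-++ (C false e) {C true f} = ≤-trans
          (≤-reflexive (arith (length (C true e)) (length (C false f)) (length (C false e)) (length (C true f))))
          (+-mono-≤ (length-chord deep he) (length-chord deep hf))
          where
          arith : ∀ p q r s → p + q + (r + s) ≡ p + r + (s + q)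
          arith = solve-∀
        balance : prodOver w l ≡ prodOver w m
        balance rewrite prodOver-++ w (C true e) (C false f) | prodOver-++ w (C false e) (C true f)
                      | chord-defect he pe | chord-defect hf pf = arith r (prodOver w (C false e)) (prodOver w (C false f))
          where
          arith : ∀ r p q → r * r * p * q ≡ p * (r * r * q)
          arith = solve-∀
        count-chord : ∀ s {a g} → a ≢ g → count a (C s g) ≡ count a (P s (x g)) + count a (P s (y g))
        count-chord s {a} {g} a≢g = trans (count-extend s (parity t (x g)) _ a≢g) (count-++ a (P s (x g)) _)
        absent : ∀ s {a g} → Extra a → Extra g → a ≢ g → count a (C s g) ≡ 0
        absent s ha hg a≢g = trans (count-chord s a≢g)
          (cong₂ _+_ (∉⇒count≡0 (extra∉path ha s (x∈ hg))) (∉⇒count≡0 (extra∉path ha s (y∈ hg))))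
        own : ∀ {a} → Extra a → (count a (C true a) ≡ 1 × count a (C false a) ≡ 0) ⊎ (count a (C true a) ≡ 0 × count a (C false a) ≡ 1)
        own {a} ha with parity t (x a)
        ... | true = inj₂ (zeros true , trans (count-head a _) (cong suc (zeros false)))
          where
          zeros : ∀ s → count a (P s (x a) ++ P s (y a)) ≡ 0
          zeros s = trans (count-++ a (P s (x a)) _) (cong₂ _+_ (∉⇒count≡0 (extra∉path ha s (x∈ ha))) (∉⇒count≡0 (extra∉path ha s (y∈ ha))))
        ... | false = inj₁ (trans (count-head a _) (cong suc (zeros true)) , zeros false)
          where
          zeros : ∀ s → count a (P s (x a) ++ P s (y a)) ≡ 0
          zeros s = trans (count-++ a (P s (x a)) _) (cong₂ _+_ (∉⇒count≡0 (extra∉path ha s (x∈ ha))) (∉⇒count≡0 (extra∉path ha s (y∈ ha))))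
        differ : count e l ≢ count e m
        differ eq rewrite count-++ e (C true e) (C false f) | count-++ e (C false e) (C true f)
                        | absent false he hf e≢f | absent true he hf e≢f with own he
        ... | inj₁ (eq₁ , eq₂) rewrite eq₁ | eq₂ with () ← eq
        ... | inj₂ (eq₁ , eq₂) rewrite eq₁ | eq₂ with () ← eq
        -- An edge counted twice for `g` is above both of its ends, hence above `v`, hence on the
        -- root path of an end of `h`: the count for `h` is at least one.
        covered : ∀ s a {g h} → Extra g → OnCycle t v (x g) (y g) → OnCycle t v (x h) (y h) →
                  count a (P s (x g)) + count a (P s (y g)) ≤ suc (count a (P s (x h)) + count a (P s (y h)))
        covered s a {g} {h} hg og oh with a ∈? P s (x g) | a ∈? P s (y g)
        ... | no a∉ | _ rewrite ∉⇒count≡0 a∉ = ≤-trans (count-path-≤1 t s (y∈ hg) a) (s≤s z≤n)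
        ... | _ | no a∉ rewrite ∉⇒count≡0 a∉ | +-identityʳ (count a (P s (x g))) = ≤-trans (count-path-≤1 t s (x∈ hg) a) (s≤s z≤n)
        ... | yes a∈x | yes a∈y = ≤-trans (+-mono-≤ (count-path-≤1 t s (x∈ hg) a) (count-path-≤1 t s (y∈ hg) a)) (s≤s above-other)
          where
          ∈⇒count≥1 : ∀ {k} → a ∈ k → 1 ≤ count a k
          ∈⇒count≥1 a∈ = n≢0⇒n>0 λ c≡0 → count≡0⇒∉ c≡0 a∈
          a∈v : a ∈ P s v
          a∈v = OnCycle.above og s a∈x a∈y
          above-other : 1 ≤ count a (P s (x h)) + count a (P s (y h))
          above-other with OnCycle.below oh
          ... | inj₁ ⊆x = ≤-trans (∈⇒count≥1 (⊆x s a∈v)) (m≤m+n _ _)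
          ... | inj₂ ⊆y = ≤-trans (∈⇒count≥1 (⊆y s a∈v)) (m≤n+m _ _)
        near-own : ∀ {p q} → (p ≡ 1 × q ≡ 0) ⊎ (p ≡ 0 × q ≡ 1) → p ≤ suc q × q ≤ suc p
        near-own (inj₁ (refl , refl)) = ≤-refl , z≤n
        near-own (inj₂ (refl , refl)) = z≤n , ≤-refl
        near : Near l m
        near a rewrite count-++ a (C true e) (C false f) | count-++ a (C false e) (C true f) with a ≟ₑ e | a ≟ₑ f
        ... | yes refl | _ rewrite absent false he hf e≢f | absent true he hf e≢f
                                 | +-identityʳ (count e (C true e)) | +-identityʳ (count e (C false e)) = near-own (own he)
        ... | no _ | yes refl rewrite absent false hf he (e≢f ∘ sym) | absent true hf he (e≢f ∘ sym) = swap (near-own (own hf))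
        ... | no a≢e | no a≢f rewrite count-chord true a≢e | count-chord false a≢e | count-chord true a≢f | count-chord false a≢f
              with one-sided a
        ...   | inj₁ zero₁ rewrite zero₁ (x∈ he) | zero₁ (y∈ he) | zero₁ (x∈ hf) | zero₁ (y∈ hf)
                                 | +-identityʳ (count a (P false (x e)) + count a (P false (y e)))
                = covered false a hf of oe , covered false a he oe of
        ...   | inj₂ zero₀ rewrite zero₀ (x∈ he) | zero₀ (y∈ he) | zero₀ (x∈ hf) | zero₀ (y∈ hf)
                                 | +-identityʳ (count a (P true (x e)) + count a (P true (y e)))
                = covered true a he oe of , covered true a hf of oe

    -- Charging odd cycles to vertices

    module Component (small : ℕ → Bool) (small-end : ∀ e → small (x e) ≡ true ⊎ small (y e) ≡ true)
                     (c : ℕ → ℕ) (c-small : ∀ {v} → small v ≡ true → 1 ≤ c v) (c-loop : ∀ {e} → x e ≡ y e → 2 ≤ c (x e))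
                     {vs} (t : Tree F r vs) {d L} (deep : ∀ {v} → v ∈ vs → depth t v ≤ d)
                     (bound : suc (d + d) + suc (d + d) ≤ L) where

      record Charge (e : A) : Set where
        constructor mkCharge
        field
          hs      : List ℕ
          unique  : Unique hs
          onCycles : ∀ {h} → h ∈ hs → OnCycle t h (x e) (y e)
          heavy   : 2 ≤ sumOver c hs

      chargePair : ∀ {e g h} → g ≢ h → small g ≡ true → small h ≡ true →
                   OnCycle t g (x e) (y e) → OnCycle t h (x e) (y e) → Charge e
      chargePair {g = g} {h} g≢h sg sh og oh = mkCharge (g ∷ h ∷ [])
        (unique-∷ (λ { (here g≡h) → g≢h g≡h }) (unique-∷ (λ ()) []))
        (λ { (here refl) → og ; (there (here refl)) → oh })
        (+-mono-≤ (c-small sg) (≤-trans (c-small sh) (m≤m+n _ _)))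

      -- Every odd cycle carries weight two. For a loop this is `c-loop`. If just one end is small,
      -- equal parities give different classes and `findPair` applies. If the ends agree, both are
      -- small, because `e` has a small end.
      charge : ∀ {e} → Extra t e → parity t (x e) ≡ parity t (y e) → Charge e
      charge {e} he same with x e ≟ y e
      ... | yes loop = mkCharge (x e ∷ []) (unique-∷ (λ ()) []) (λ { (here refl) → onCycle-left (Extra.x∈ he) })
                         (≤-trans (c-loop loop) (m≤m+n _ _))
      ... | no x≢y with small (x e) Bool.≟ small (y e)
      ...   | no differ with findPair small small-end t (Extra.x∈ he) (Extra.y∈ he)
                               (differ ∘ λ eq → xor-cancel (parity t (x e)) (trans eq (cong (_xor small (y e)) (sym same))))
        where
        xor-cancel : ∀ q {s s′} → q xor s ≡ q xor s′ → s ≡ s′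
        xor-cancel true eq = Bool.not-injective eq
        xor-cancel false eq = eq
      ...     | smallPair g≢h sg sh og oh = chargePair g≢h sg sh og oh
      charge {e} he same | no x≢y | yes eq with small-end e
      ... | inj₁ sx = chargePair x≢y sx (trans (sym eq) sx) (onCycle-left (Extra.x∈ he)) (onCycle-right (Extra.y∈ he))
      ... | inj₂ sy = chargePair x≢y (trans eq sy) sy (onCycle-left (Extra.x∈ he)) (onCycle-right (Extra.y∈ he))

      -- `owner` remembers a cycle through each charged vertex; when a later cycle claims the same
      -- vertex, the two feed `oddTrail`.
      record Packing (K : List A) : Set where
        field
          H      : List ℕ
          unique : Unique H
          owner  : ∀ {h} → h ∈ H → ∃[ f ] f ∈ K × parity t (x f) ≡ parity t (y f) × OnCycle t h (x f) (y f)
          heavy  : 2 * length K ≤ sumOver c H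

      packing : ∀ K → Unique K → (∀ {e} → e ∈ K → Extra t e) → Trail L F ⊎ Packing K
      packing [] _ _ = inj₂ record { H = [] ; unique = [] ; owner = λ () ; heavy = z≤n }
      packing (e ∷ K) uK@(_ ∷ uK′) extras with packing K uK′ (extras ∘ there) | parity t (x e) Bool.≟ parity t (y e)
      ... | inj₁ tr | _ = inj₁ tr
      ... | inj₂ _ | no differ with parity t (x e) in px | parity t (y e) in py
      ...   | true | true = ⊥-elim (differ refl)
      ...   | false | false = ⊥-elim (differ refl)
      ...   | false | true = inj₁ (evenTrail t deep (m+n≤o⇒m≤o _ bound) ∈edges (inj₁ (refl , refl)) x∈ y∈ ∉edges px py)
        where open Extra (extras (here refl))
      ...   | true | false = inj₁ (evenTrail t deep (m+n≤o⇒m≤o _ bound) ∈edges (inj₂ (refl , refl)) y∈ x∈ ∉edges py px)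
        where open Extra (extras (here refl))
      packing (e ∷ K) uK extras | inj₂ P | yes same with charge (extras (here refl)) same
      ... | mkCharge hs uhs onC heavy₂ with Any.any? (λ h → h ∈ℕ? Packing.H P) hs
      ...   | yes shared with find shared
      ...     | h , h∈hs , h∈H with Packing.owner P h∈H
      ...       | f , f∈K , same-f , of = inj₁ (oddTrail t deep bound e≢f (extras (here refl)) (extras (there f∈K))
                                                 same same-f (onC h∈hs) of)
        where
        e≢f : e ≢ f
        e≢f refl = Unique[x∷xs]⇒x∉xs uK f∈K
      packing (e ∷ K) uK extras | inj₂ P | yes same | mkCharge hs uhs onC heavy₂ | no separate = inj₂ record
        { H = hs ++ H
        ; unique = Unique.++⁺ uhs unique λ (h∈hs , h∈H) → separate (lose h∈hs h∈H)
        ; owner = λ h∈ → [ (λ h∈hs → e , here refl , same , onC h∈hs)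
                         , (λ h∈H → let f , f∈K , rest = owner h∈H in f , there f∈K , rest) ]′ (∈-++⁻ hs h∈)
        ; heavy = begin
            2 * suc (length K)              ≡⟨ *-suc 2 (length K) ⟩
            2 + 2 * length K                ≤⟨ +-mono-≤ heavy₂ heavy ⟩
            sumOver c hs + sumOver c H      ≡⟨ sumOver-++ c hs H ⟨
            sumOver c (hs ++ H)             ∎ }
        where
        open Packing P
        open ≤-Reasoning

      component : ∀ K → Unique K → (∀ {e} → e ∈ K → Extra t e) → Trail L F ⊎ 2 * length K ≤ sumOver c vs
      component K uK extras = Sum.map₂
        (λ P → ≤-trans (Packing.heavy P) (sumOver-⊆ c (Packing.unique P)
                 λ h∈ → OnCycle.vertex (proj₂ (proj₂ (proj₂ (Packing.owner P h∈))))))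
        (packing K uK extras)

      -- There is at most one tree edge per vertex, and twice the number of extra edges is at most
      -- the total of `c`. Doubling gives the weight 2 + c v.
      double-count : ∀ K → Unique K → (∀ {e} → e ∈ K → e ∈ F × x e ∈ vs × y e ∈ vs) →
                     Trail L F ⊎ 2 * length K ≤ sumOver (λ v → 2 + c v) vs
      double-count K uK ends = Sum.map₂ count-both (component extras (Unique.filter⁺ _ uK) extras-extra)
        where
        treeEdges = edges t true ++ edges t false
        inTree? : ∀ e → Dec (e ∈ treeEdges)
        inTree? e = e ∈? treeEdges
        extras = filter (¬? ∘ inTree?) K
        extras-extra : ∀ {e} → e ∈ extras → Extra t e
        extras-extra e∈ with ∈-filter⁻ (¬? ∘ inTree?) {xs = K} e∈
        ... | e∈K , e∉ with ends e∈K
        ...   | e∈F , x∈ , y∈ = extra e∈F x∈ y∈ λ { true → e∉ ∘ ∈-++⁺ˡ ; false → e∉ ∘ ∈-++⁺ʳ (edges t true) }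
        count-both : 2 * length extras ≤ sumOver c vs → 2 * length K ≤ sumOver (λ v → 2 + c v) vs
        count-both le = begin
          2 * length K                                           ≡⟨ cong (2 *_) (length-filter-+ inTree? K) ⟨
          2 * (length (filter inTree? K) + length extras)        ≡⟨ *-distribˡ-+ 2 (length (filter inTree? K)) (length extras) ⟩
          2 * length (filter inTree? K) + 2 * length extras      ≤⟨ +-mono-≤ (*-monoʳ-≤ 2 (≤-trans in-tree (length-edges t))) le ⟩
          2 * length vs + sumOver c vs                           ≡⟨ sumOver-2+ c vs ⟨
          sumOver (λ v → 2 + c v) vs                                      ∎
          where
          open ≤-Reasoning
          in-tree : length (filter inTree? K) ≤ length treeEdges
          in-tree = length-⊆ (Unique.filter⁺ inTree? uK) λ e∈ → proj₂ (∈-filter⁻ inTree? {xs = K} e∈)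

-- Ball growing

module BallGrowing {A : Set} (_≟ₑ_ : DecidableEquality A) (x y : A → ℕ)
                   (x>0 : ∀ e → 1 ≤ x e) (y>0 : ∀ e → 1 ≤ y e) where

  open Graph _≟ₑ_ x y x>0 y>0
  open DecMembership _≟ₑ_ using (_∈?_)

  inside? : ∀ vs e → Dec (x e ∈ vs × y e ∈ vs)
  inside? vs e = (x e ∈ℕ? vs) ×-dec (y e ∈ℕ? vs)

  touching? : ∀ vs e → Dec (x e ∈ vs ⊎ y e ∈ vs)
  touching? vs e = (x e ∈ℕ? vs) ⊎-dec (y e ∈ℕ? vs)

  module _ (F : List A) where

    inside touching : List ℕ → ℕ
    inside vs = length (filter (inside? vs) F)
    touching vs = length (filter (touching? vs) F)

    module _ {r : ℕ} where

      -- `vs₀` is the ball before the layer, fixed while the tree grows: new vertices are attached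
      -- to it alone, so depth rises by only one. By `done`, no vertex left outside is adjacent to
      -- the old ball.
      record Layer {vs} (t : Tree F r vs) (vs₀ out : List ℕ) (d : ℕ) : Set where
        constructor mkLayer
        field
          {vs′ out′} : List ℕ
          tree : Tree F r vs′
          perm : vs′ ++ out′ ↭ vs ++ out
          deep : ∀ {v} → v ∈ vs′ → depth tree v ≤ suc d
          ⊇vs  : vs ⊆ vs′
          done : ∀ {u e p} → u ∈ out′ → e ∈ F → p ∈ vs₀ → ¬ Joins e u p

      Attached : List ℕ → ℕ → A → Set
      Attached vs u e = ∃[ p ] p ∈ vs × Joins e u p

      attached? : ∀ vs u e → Dec (Attached vs u e)
      attached? vs u e = map′ to from (((x e ≟ u) ×-dec (y e ∈ℕ? vs)) ⊎-dec ((y e ≟ u) ×-dec (x e ∈ℕ? vs)))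
        where
        to : (x e ≡ u × y e ∈ vs) ⊎ (y e ≡ u × x e ∈ vs) → Attached vs u e
        to (inj₁ (xu , y∈)) = y e , y∈ , inj₁ (xu , refl)
        to (inj₂ (yu , x∈)) = x e , x∈ , inj₂ (refl , yu)
        from : Attached vs u e → (x e ≡ u × y e ∈ vs) ⊎ (y e ≡ u × x e ∈ vs)
        from (p , p∈ , inj₁ (xu , refl)) = inj₁ (xu , p∈)
        from (p , p∈ , inj₂ (refl , yu)) = inj₂ (yu , p∈)

      layer : ∀ {vs} (t : Tree F r vs) {vs₀ d} out → Unique (vs ++ out) → vs₀ ⊆ vs →
              (∀ {v} → v ∈ vs₀ → depth t v ≤ d) → (∀ {v} → v ∈ vs → depth t v ≤ suc d) → Layer t vs₀ out d
      layer t [] uniq vs₀⊆ deep₀ deep = mkLayer t ↭-refl deep id λ ()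
      layer {vs} t {vs₀} {d} (u ∷ out) uniq vs₀⊆ deep₀ deep with Any.any? (attached? vs₀ u) F
      ... | yes hit with find hit
      ...   | e , e∈ , p , p∈ , j with layer (graft t u∉ (vs₀⊆ p∈) e∈ j) out (unique-resp-↭ (shift u vs out) uniq) (there ∘ vs₀⊆)
                                            (λ v∈ → subst (_≤ d) (sym (depth-old t u∉ (vs₀⊆ p∈) e∈ j (vs₀⊆ v∈))) (deep₀ v∈))
                                            (λ { (here refl) → subst (_≤ suc d) (sym (depth-new t u∉ (vs₀⊆ p∈) e∈ j)) (s≤s (deep₀ p∈))
                                               ; (there v∈) → subst (_≤ suc d) (sym (depth-old t u∉ (vs₀⊆ p∈) e∈ j v∈)) (deep v∈) })
        where
        u∉ : u ∉ vs
        u∉ u∈ = proj₂ (proj₂ (unique-++⁻ vs uniq)) u∈ (here refl)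
      ...     | mkLayer t′ perm deep′ ⊇ done = mkLayer t′ (↭-trans perm (↭-sym (shift u vs out))) deep′ (⊇ ∘ there) done
      layer {vs} t {vs₀} (u ∷ out) uniq vs₀⊆ deep₀ deep | no miss
        with layer t out (AllPairs.tail (unique-resp-↭ (shift u vs out) uniq)) vs₀⊆ deep₀ deep
      ... | mkLayer {vs′} {out′} t′ perm deep′ ⊇ done = mkLayer t′
              (↭-trans (shift u vs′ out′) (↭-trans (↭-prep u perm) (↭-sym (shift u vs out)))) deep′ ⊇
              λ { (here refl) e∈ p∈ j → miss (lose e∈ (_ , p∈ , j)) ; (there u∈) → done u∈ }

      -- `thin` means that the edges leaving the ball number at most a k-th of those inside.
      record Ball (k R : ℕ) (Vs : List ℕ) : Set where
        field
          {vs out} : List ℕ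
          tree : Tree F r vs
          perm : vs ++ out ↭ Vs
          deep : ∀ {v} → v ∈ vs → depth tree v ≤ R
          thin : k * touching vs ≤ suc k * inside vs

      -- A layer swallows every edge that touches the ball. If the ball is not thin,
      -- `suc (inside vs)` thus grows by a factor of at least (k + 1) / k; the successor gives the
      -- growth a start at zero edges. After R such layers it would exceed `suc (length F)`, against
      -- `few`.
      grow : ∀ {k R Vs} → Unique F → Unique Vs → (∀ {e} → e ∈ F → x e ∈ Vs × y e ∈ Vs) →
             k ^ R * suc (length F) < suc k ^ R →
             ∀ fuel {d} → d + fuel ≡ R → ∀ {vs out} (t : Tree F r vs) → vs ++ out ↭ Vs →
             (∀ {v} → v ∈ vs → depth t v ≤ d) → suc k ^ d ≤ k ^ d * suc (inside vs) → Ball k R Vs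
      grow {k} {R} {Vs} uF uVs ends few fuel {d} d+fuel {vs} {out} t perm deep large
        with k * touching vs ≤? suc k * inside vs
      ... | yes thin = record { tree = t ; perm = perm ; deep = λ v∈ → ≤-trans (deep v∈) (m+n≤o⇒m≤o _ (≤-reflexive d+fuel)) ; thin = thin }
      grow {k} {R} uF uVs ends few zero {d} d+fuel {vs} t perm deep large | no thick
        with refl ← trans (sym (+-identityʳ d)) d+fuel =
        ⊥-elim (<⇒≱ few (≤-trans large (*-monoʳ-≤ (k ^ d) (s≤s (length-filter (inside? vs) F)))))
      grow {k} {R} {Vs} uF uVs ends few (suc fuel) {d} d+fuel {vs} {out} t perm deep large | no thick
        with layer t {vs} out (unique-resp-↭ (↭-sym perm) uVs) id deep (m≤n⇒m≤1+n ∘ deep)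
      ... | mkLayer {vs′} {out′} t′ perm′ deep′ ⊇vs done =
        grow uF uVs ends few fuel (trans (sym (+-suc d fuel)) d+fuel) t′ (↭-trans perm′ perm) deep′ (begin
          suc k * suc k ^ d                       ≤⟨ *-monoʳ-≤ (suc k) large ⟩
          suc k * (k ^ d * suc (inside vs))       ≡⟨ x∙yz≈y∙xz (suc k) (k ^ d) (suc (inside vs)) ⟩
          k ^ d * (suc k * suc (inside vs))       ≤⟨ *-monoʳ-≤ (k ^ d) enlarged ⟩
          k ^ d * (k * suc (inside vs′))          ≡⟨ *-assoc (k ^ d) k _ ⟨
          k ^ d * k * suc (inside vs′)            ≡⟨ cong (_* suc (inside vs′)) (*-comm (k ^ d) k) ⟩
          k * k ^ d * suc (inside vs′)            ∎)
        where
        open ≤-Reasoning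
        split : ∀ {v} → v ∈ Vs → v ∈ vs′ ⊎ v ∈ out′
        split v∈ = ∈-++⁻ vs′ (∈-resp-↭ (↭-sym (↭-trans perm′ perm)) v∈)
        swallow : filter (touching? vs) F ⊆ filter (inside? vs′) F
        swallow {e} e∈ with ∈-filter⁻ (touching? vs) {xs = F} e∈
        ... | e∈F , inj₁ x∈ with split (proj₂ (ends e∈F))
        ...   | inj₁ y∈ = ∈-filter⁺ (inside? vs′) e∈F (⊇vs x∈ , y∈)
        ...   | inj₂ y∈ = ⊥-elim (done y∈ e∈F x∈ (inj₂ (refl , refl)))
        swallow {e} e∈ | e∈F , inj₂ y∈ with split (proj₁ (ends e∈F))
        ...   | inj₁ x∈ = ∈-filter⁺ (inside? vs′) e∈F (x∈ , ⊇vs y∈)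
        ...   | inj₂ x∈ = ⊥-elim (done x∈ e∈F y∈ (inj₁ (refl , refl)))
        enlarged : suc k * suc (inside vs) ≤ k * suc (inside vs′)
        enlarged = begin
          suc k * suc (inside vs)                 ≡⟨ *-suc (suc k) (inside vs) ⟩
          suc k + suc k * inside vs               ≡⟨ +-suc k _ ⟨
          k + suc (suc k * inside vs)             ≤⟨ +-monoʳ-≤ k (≰⇒> thick) ⟩
          k + k * touching vs                     ≤⟨ +-monoʳ-≤ k (*-monoʳ-≤ k (length-⊆ (Unique.filter⁺ (touching? vs) uF) swallow)) ⟩
          k + k * inside vs′                      ≡⟨ *-suc k (inside vs′) ⟨
          k * suc (inside vs′)                    ∎

  trail-⊆ : ∀ {L F G} → F ⊆ G → Trail L F → Trail L G
  trail-⊆ F⊆G tr = record { Trail tr ; ⊆edges = F⊆G ∘ Trail.⊆edges tr }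

  module Sparse (small : ℕ → Bool) (small-end : ∀ e → small (x e) ≡ true ⊎ small (y e) ≡ true)
                (c : ℕ → ℕ) (c-small : ∀ {v} → small v ≡ true → 1 ≤ c v) (c-loop : ∀ {e} → x e ≡ y e → 2 ≤ c (x e))
                (k : ℕ) {R L : ℕ} (bound : suc (R + R) + suc (R + R) ≤ L) where

    weight : ℕ → ℕ
    weight v = 2 + c v

    -- C counts the edges cut between different balls.
    Bounded : List A → List ℕ → Set
    Bounded F Vs = ∃[ C ] k * C ≤ length F × 2 * length F ≤ 2 * C + sumOver weight Vs

    -- All edges touching the first ball are deleted before the next ball is grown. A cut edge is
    -- thus counted only once, against the inner edges of the ball that it leaves, and both inner
    -- edges and vertices of different balls are disjoint. A ball contains its root, so the supply
    -- of vertices shrinks.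
    sparse′ : ∀ fuel Vs → length Vs ≤ fuel → Unique Vs → ∀ F → Unique F → (∀ {e} → e ∈ F → x e ∈ Vs × y e ∈ Vs) →
              k ^ R * suc (length F) < suc k ^ R → Trail L F ⊎ Bounded F Vs
    sparse′ fuel [] _ _ [] _ _ _ = inj₂ (0 , ≤-reflexive (*-zeroʳ k) , z≤n)
    sparse′ fuel [] _ _ (e ∷ F) _ ends _ with () ← proj₁ (ends (here refl))
    sparse′ (suc fuel) (r ∷ Vs) (s≤s len) uVs F uF ends few
      with grow F {r} {k} uF uVs ends few R {0} refl root ↭-refl (λ { (here refl) → z≤n }) (s≤s z≤n)
    ... | record { vs = vs ; out = out ; tree = t ; perm = perm ; deep = deep ; thin = thin }
      with Component.double-count small small-end c c-small c-loop t deep bound (filter (inside? vs) F) (Unique.filter⁺ (inside? vs) uF)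
             (∈-filter⁻ (inside? vs))
         | sparse′ fuel out shorter (proj₁ (proj₂ (unique-++⁻ vs (unique-resp-↭ (↭-sym perm) uVs))))
             rest (Unique.filter⁺ (¬? ∘ touching? vs) uF) rest-ends
             (≤-<-trans (*-monoʳ-≤ (k ^ R) (s≤s (length-filter (¬? ∘ touching? vs) F))) few)
      where
      rest = filter (¬? ∘ touching? vs) F
      root∈ : ∀ {vs} → Tree F r vs → r ∈ vs
      root∈ root = here refl
      root∈ (graft t _ _ _ _) = there (root∈ t)
      shorter : length out ≤ fuel
      shorter = ≤-trans (≤-pred (begin
        1 + length out         ≤⟨ +-monoˡ-≤ (length out) (∈-length (root∈ t)) ⟩
        length vs + length out ≡⟨ length-++ vs ⟨
        length (vs ++ out)     ≡⟨ ↭-length perm ⟩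
        suc (length Vs)        ∎)) len
        where open ≤-Reasoning
      outside : ∀ {v} → v ∈ r ∷ Vs → v ∉ vs → v ∈ out
      outside v∈ v∉ with ∈-++⁻ vs (∈-resp-↭ (↭-sym perm) v∈)
      ... | inj₁ v∈vs = ⊥-elim (v∉ v∈vs)
      ... | inj₂ v∈out = v∈out
      rest-ends : ∀ {e} → e ∈ rest → x e ∈ out × y e ∈ out
      rest-ends e∈ with ∈-filter⁻ (¬? ∘ touching? vs) {xs = F} e∈
      ... | e∈F , free with ends e∈F
      ...   | x∈ , y∈ = outside x∈ (free ∘ inj₁) , outside y∈ (free ∘ inj₂)
    ... | inj₁ tr | _ = inj₁ tr
    ... | inj₂ _ | inj₁ tr = inj₁ (trail-⊆ (proj₁ ∘ ∈-filter⁻ (¬? ∘ touching? vs)) tr)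
    ... | inj₂ inside≤ | inj₂ (C , kC≤ , rest≤) = inj₂ (cut + C , cut-few , total)
      where
      open ≤-Reasoning
      rest = filter (¬? ∘ touching? vs) F
      touch = touching F vs
      ins = inside F vs
      ins≤touch : ins ≤ touch
      ins≤touch = length-⊆ (Unique.filter⁺ (inside? vs) uF) λ e∈ →
        let e∈F , x∈ , _ = ∈-filter⁻ (inside? vs) {xs = F} e∈ in ∈-filter⁺ (touching? vs) e∈F (inj₁ x∈)
      cut = touch ∸ ins
      touch≡ : touch ≡ ins + cut
      touch≡ = sym (m+[n∸m]≡n ins≤touch)
      F≡ : touch + length rest ≡ length F
      F≡ = length-filter-+ (touching? vs) F
      k*cut≤ins : k * cut ≤ ins
      k*cut≤ins = +-cancelˡ-≤ (k * ins) _ _ (begin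
        k * ins + k * cut  ≡⟨ *-distribˡ-+ k ins cut ⟨
        k * (ins + cut)    ≡⟨ cong (k *_) touch≡ ⟨
        k * touch          ≤⟨ thin ⟩
        ins + k * ins      ≡⟨ +-comm ins _ ⟩
        k * ins + ins      ∎)
      cut-few : k * (cut + C) ≤ length F
      cut-few = begin
        k * (cut + C)        ≡⟨ *-distribˡ-+ k cut C ⟩
        k * cut + k * C      ≤⟨ +-mono-≤ (≤-trans k*cut≤ins ins≤touch) kC≤ ⟩
        touch + length rest  ≡⟨ F≡ ⟩
        length F             ∎
      total : 2 * length F ≤ 2 * (cut + C) + sumOver weight (r ∷ Vs)
      total = begin
        2 * length F                                                              ≡⟨ cong (2 *_) F≡ ⟨
        2 * (touch + length rest)                                                 ≡⟨ cong (λ n → 2 * (n + length rest)) touch≡ ⟩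
        2 * (ins + cut + length rest)                                             ≡⟨ arith₁ ins cut (length rest) ⟩
        2 * ins + 2 * cut + 2 * length rest                                       ≤⟨ +-mono-≤ (+-monoˡ-≤ (2 * cut) inside≤) rest≤ ⟩
        sumOver weight vs + 2 * cut + (2 * C + sumOver weight out)                ≡⟨ arith₂ (sumOver weight vs) cut C _ ⟩
        2 * (cut + C) + (sumOver weight vs + sumOver weight out)                  ≡⟨ cong (2 * (cut + C) +_) (sumOver-++ weight vs out) ⟨
        2 * (cut + C) + sumOver weight (vs ++ out)                                ≡⟨ cong (2 * (cut + C) +_) (sumOver-↭ weight perm) ⟩
        2 * (cut + C) + sumOver weight (r ∷ Vs)                                   ∎
        where
        arith₁ : ∀ p q s → 2 * (p + q + s) ≡ 2 * p + 2 * q + 2 * s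
        arith₁ = solve-∀
        arith₂ : ∀ p q s t → p + 2 * q + (2 * s + t) ≡ 2 * (q + s) + (p + t)
        arith₂ = solve-∀

    sparse : ∀ {Vs} → Unique Vs → ∀ F → Unique F → (∀ {e} → e ∈ F → x e ∈ Vs × y e ∈ Vs) →
             k ^ R * suc (length F) < suc k ^ R → Trail L F ⊎ Bounded F Vs
    sparse {Vs} = sparse′ (length Vs) Vs ≤-refl

    -- Every trail removed costs at most `L` edges and has at least one, so the process stops. The
    -- hypothesis on the radius passes to sublists.
    exhaust : ∀ {Vs} → Unique Vs → ∀ fuel F → length F ≤ fuel → Unique F → (∀ {e} → e ∈ F → x e ∈ Vs × y e ∈ Vs) →
              k ^ R * suc (length F) < suc k ^ R →
              ∃[ fs ] Unique (supports {w = w} fs) × supports fs ⊆ F ×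
              ∃[ C ] k * C ≤ length F × 2 * length F ≤ 2 * (L * length fs) + (2 * C + sumOver weight Vs)
    exhaust uVs fuel F len uF ends few with sparse uVs F uF ends few
    ... | inj₂ (C , kC≤ , F≤) = [] , [] , (λ ()) , C , kC≤ ,
            ≤-trans F≤ (m≤n+m _ (2 * (L * 0)))
    exhaust uVs zero [] len uF ends few | inj₁ tr with () ← Trail.⊆edges tr (proj₂ (Trail.nonempty tr))
    exhaust uVs zero (_ ∷ _) () uF ends few | inj₁ tr
    exhaust {Vs} uVs (suc fuel) F len uF ends few | inj₁ tr
      with exhaust uVs fuel rest (≤-pred (≤-trans shorter len)) (Unique.filter⁺ outside? uF)
             (ends ∘ proj₁ ∘ ∈-filter⁻ outside?)
             (≤-<-trans (*-monoʳ-≤ (k ^ R) (s≤s (length-filter outside? F))) few)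
      where
      open Trail tr
      outside? : ∀ e → Dec (e ∉ S ++ T)
      outside? e = ¬? (e ∈? S ++ T)
      rest = filter outside? F
      shorter : length rest < length F
      shorter = filter-notAll outside? F (lose (⊆edges (proj₂ nonempty)) λ out → out (proj₂ nonempty))
    ... | fs , ufs , fs⊆ , C , kC≤ , rest≤ = exchange ∷ fs
        , Unique.++⁺ unique ufs (λ (e∈tr , e∈fs) → proj₂ (∈-filter⁻ outside? {xs = F} (fs⊆ e∈fs)) e∈tr)
        , [ ⊆edges , proj₁ ∘ ∈-filter⁻ outside? ∘ fs⊆ ]′ ∘ ∈-++⁻ (S ++ T)
        , C , ≤-trans kC≤ (length-filter outside? F) , total
      where
      open Trail tr
      exchange : Exchange w
      exchange = record { S = S ; T = T ; nonempty = nonempty ; balanced = balanced }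
      outside? : ∀ e → Dec (e ∉ S ++ T)
      outside? e = ¬? (e ∈? S ++ T)
      rest = filter outside? F
      inner = filter (_∈? S ++ T) F
      total : 2 * length F ≤ 2 * (L * suc (length fs)) + (2 * C + sumOver weight Vs)
      total = begin
        2 * length F                                                         ≡⟨ cong (2 *_) (length-filter-+ (_∈? S ++ T) F) ⟨
        2 * (length inner + length rest)                                     ≡⟨ *-distribˡ-+ 2 (length inner) (length rest) ⟩
        2 * length inner + 2 * length rest                                   ≤⟨ +-mono-≤ (*-monoʳ-≤ 2 (≤-trans inner≤ short)) rest≤ ⟩
        2 * L + (2 * (L * length fs) + (2 * C + sumOver weight Vs))          ≡⟨ arith L (length fs) _ ⟩
        2 * (L * suc (length fs)) + (2 * C + sumOver weight Vs)              ∎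
        where
        open ≤-Reasoning
        inner≤ : length inner ≤ length (S ++ T)
        inner≤ = length-⊆ (Unique.filter⁺ (_∈? S ++ T) uF) λ e∈ → proj₂ (∈-filter⁻ (_∈? S ++ T) {xs = F} e∈)
        arith : ∀ p q s → 2 * p + (2 * (p * q) + s) ≡ 2 * (p * suc q) + s
        arith = solve-∀

-- Counting products of exchanges

toSubset : ∀ {n} → List (Fin n) → Subset n
toSubset [] = Vec.replicate _ false
toSubset (i ∷ l) = toSubset l [ i ]≔ true

∈⇒toSubset : ∀ {n} {i : Fin n} {l} → i ∈ l → Vec.lookup (toSubset l) i ≡ true
∈⇒toSubset {l = i ∷ l} (here refl) = Vec.lookup∘update i (toSubset l) true
∈⇒toSubset {i = i} {l = j ∷ l} (there i∈) with i Fin.≟ j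
... | yes refl = Vec.lookup∘update i (toSubset l) true
... | no i≢j = trans (Vec.lookup∘update′ i≢j (toSubset l) true) (∈⇒toSubset i∈)

toSubset⇒∈ : ∀ {n} {i : Fin n} l → Vec.lookup (toSubset l) i ≡ true → i ∈ l
toSubset⇒∈ {i = i} [] eq with () ← trans (sym (Vec.lookup-replicate i false)) eq
toSubset⇒∈ {i = i} (j ∷ l) eq with i Fin.≟ j
... | yes i≡j = here i≡j
... | no i≢j = there (toSubset⇒∈ l (trans (sym (Vec.lookup∘update′ i≢j (toSubset l) true)) eq))

subsetProd-⊥ : ∀ {n} (a : Fin n → ℕ) → subsetProd a (Vec.replicate n false) ≡ 1
subsetProd-⊥ {zero} a = refl
subsetProd-⊥ {suc n} a = subsetProd-⊥ (a ∘ fsuc)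

subsetProd-insert : ∀ {n} (a : Fin n → ℕ) (s : Subset n) i → Vec.lookup s i ≡ false →
                    subsetProd a (s [ i ]≔ true) ≡ a i * subsetProd a s
subsetProd-insert a (false ∷ s) fzero refl = refl
subsetProd-insert a (true ∷ s) (fsuc i) eq = trans (cong (a fzero *_) (subsetProd-insert (a ∘ fsuc) s i eq))
  (x∙yz≈y∙xz (a fzero) (a (fsuc i)) (subsetProd (a ∘ fsuc) s))
subsetProd-insert a (false ∷ s) (fsuc i) eq = subsetProd-insert (a ∘ fsuc) s i eq

subsetProd-toSubset : ∀ {n} (a : Fin n → ℕ) {l} → Unique l → subsetProd a (toSubset l) ≡ prodOver a l
subsetProd-toSubset a {[]} [] = subsetProd-⊥ a
subsetProd-toSubset a {i ∷ l} un@(_ ∷ un′) = trans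
  (subsetProd-insert a (toSubset l) i (Bool.¬-not (Unique[x∷xs]⇒x∉xs un ∘ toSubset⇒∈ l)))
  (cong (a i *_) (subsetProd-toSubset a un′))

-- Smooth numbers

-- The bases are all integers from 1 to T. A number may have several exponent vectors, but the
-- counting asks only that a vector determine its number; any positive integer up to T is then a
-- single factor.
powers : ℕ → (ℕ → ℕ) → ℕ
powers zero e = 1
powers (suc T) e = suc T ^ e (suc T) * powers T e

powers-+ : ∀ T e f → powers T (λ j → e j + f j) ≡ powers T e * powers T f
powers-+ zero e f = refl
powers-+ (suc T) e f rewrite ^-distribˡ-+-* (suc T) (e (suc T)) (f (suc T)) | powers-+ T e f =
  *-interchange (suc T ^ e (suc T)) (suc T ^ f (suc T)) (powers T e) (powers T f)

powers-cong : ∀ T {e f} → (∀ j → j < T → e (suc j) ≡ f (suc j)) → powers T e ≡ powers T f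
powers-cong zero eq = refl
powers-cong (suc T) eq = cong₂ (λ p q → suc T ^ p * q) (eq T ≤-refl) (powers-cong T λ j j<T → eq j (m≤n⇒m≤1+n j<T))

powers-0 : ∀ T {e} → (∀ j → j < T → e (suc j) ≡ 0) → powers T e ≡ 1
powers-0 zero eq = refl
powers-0 (suc T) {e} eq rewrite eq T ≤-refl | powers-0 T {e} (λ j j<T → eq j (m≤n⇒m≤1+n j<T)) = refl

record Smooth (T J m : ℕ) : Set where
  constructor mkSmooth
  field
    exponent  : ℕ → ℕ
    bounded   : ∀ j → exponent j ≤ J
    factored  : m ≡ powers T exponent

smooth-1 : ∀ {T} → Smooth T 0 1
smooth-1 {T} = mkSmooth (λ _ → 0) (λ _ → z≤n) (sym (powers-0 T λ _ _ → refl))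

smooth-* : ∀ {T J K a b} → Smooth T J a → Smooth T K b → Smooth T (J + K) (a * b)
smooth-* {T} (mkSmooth e e≤ refl) (mkSmooth f f≤ refl) =
  mkSmooth (λ j → e j + f j) (λ j → +-mono-≤ (e≤ j) (f≤ j)) (sym (powers-+ T e f))

smooth-mono : ∀ {T J K a} → J ≤ K → Smooth T J a → Smooth T K a
smooth-mono J≤K (mkSmooth e e≤ eq) = mkSmooth e (λ j → ≤-trans (e≤ j) J≤K) eq

smooth-≤ : ∀ {T a} → 1 ≤ a → a ≤ T → Smooth T 1 a
smooth-≤ {T} {suc a} _ a<T = mkSmooth δ δ≤1 (sym (powers-δ T a<T))
  where
  δ : ℕ → ℕ
  δ j = if does (j ≟ suc a) then 1 else 0
  δ≤1 : ∀ j → δ j ≤ 1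
  δ≤1 j with does (j ≟ suc a)
  ... | true = ≤-refl
  ... | false = z≤n
  δ-off : ∀ {j} → j ≢ suc a → δ j ≡ 0
  δ-off {j} ne rewrite dec-false (j ≟ suc a) ne = refl
  powers-δ : ∀ T → suc a ≤ T → powers T δ ≡ suc a
  powers-δ (suc T) (s≤s a≤T) with a ≟ T
  ... | yes refl rewrite dec-true (a ≟ a) refl | powers-0 a {δ} (λ j j<a → δ-off (<⇒≢ j<a ∘ suc-injective)) =
          trans (*-identityʳ _) (*-identityʳ _)
  ... | no a≢T rewrite δ-off {suc T} (a≢T ∘ sym ∘ suc-injective) = trans (*-identityˡ _) (powers-δ T (≤∧≢⇒< a≤T a≢T))

smooth-prod : ∀ {A : Set} {T J} (f : A → ℕ) → (∀ a → Smooth T J (f a)) → ∀ l → Smooth T (length l * J) (prodOver f l)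
smooth-prod f sm [] = smooth-1
smooth-prod f sm (a ∷ l) = smooth-* (sm a) (smooth-prod f sm l)

-- Choosing sides of exchanges

module _ {A : Set} {w : A → ℕ} where

  side : Exchange w → Fin 2 → List A
  side s fzero = Exchange.S s
  side s (fsuc _) = Exchange.T s

  side⊆support : ∀ s b → side s b ⊆ Exchange.support s
  side⊆support s fzero = ∈-++⁺ˡ
  side⊆support s (fsuc _) = ∈-++⁺ʳ (Exchange.S s)

  select : (fs : List (Exchange w)) → (Fin (length fs) → Fin 2) → List A
  select [] f = []
  select (s ∷ fs) f = side s (f fzero) ++ select fs (f ∘ fsuc)

  select⊆supports : ∀ fs f → select fs f ⊆ supports fs
  select⊆supports (s ∷ fs) f a∈ with ∈-++⁻ (side s (f fzero)) a∈
  ... | inj₁ a∈s = ∈-++⁺ˡ (side⊆support s (f fzero) a∈s)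
  ... | inj₂ a∈fs = ∈-++⁺ʳ (Exchange.support s) (select⊆supports fs (f ∘ fsuc) a∈fs)

  select-unique : ∀ fs f → Unique (supports fs) → Unique (select fs f)
  select-unique [] f un = []
  select-unique (s ∷ fs) f un with unique-++⁻ (Exchange.support s) un
  ... | us , ufs , apart = Unique.++⁺ (side-unique (f fzero)) (select-unique fs (f ∘ fsuc) ufs)
        λ (a∈s , a∈fs) → apart (side⊆support s (f fzero) a∈s) (select⊆supports fs (f ∘ fsuc) a∈fs)
    where
    side-unique : ∀ b → Unique (side s b)
    side-unique fzero = proj₁ (unique-++⁻ (Exchange.S s) us)
    side-unique (fsuc _) = proj₁ (proj₂ (unique-++⁻ (Exchange.S s) us))

  select-balanced : ∀ fs f g → prodOver w (select fs f) ≡ prodOver w (select fs g)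
  select-balanced [] f g = refl
  select-balanced (s ∷ fs) f g = begin
    prodOver w (side s (f fzero) ++ select fs (f ∘ fsuc))              ≡⟨ prodOver-++ w (side s (f fzero)) _ ⟩
    prodOver w (side s (f fzero)) * prodOver w (select fs (f ∘ fsuc))  ≡⟨ cong₂ _*_ (sides (f fzero) (g fzero)) (select-balanced fs (f ∘ fsuc) (g ∘ fsuc)) ⟩
    prodOver w (side s (g fzero)) * prodOver w (select fs (g ∘ fsuc))  ≡⟨ prodOver-++ w (side s (g fzero)) _ ⟨
    prodOver w (side s (g fzero) ++ select fs (g ∘ fsuc))              ∎
    where
    open ≡-Reasoning
    sides : ∀ b b′ → prodOver w (side s b) ≡ prodOver w (side s b′)
    sides fzero fzero = refl
    sides fzero (fsuc _) = Exchange.balanced s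
    sides (fsuc _) fzero = sym (Exchange.balanced s)
    sides (fsuc _) (fsuc _) = refl

  -- Disjoint supports allow each exchange to be examined alone. If two choices differed there, its
  -- sides would have the same elements, though they are disjoint and not both empty.
  select-injective : ∀ fs f g → Unique (supports fs) → select fs f ⊆ select fs g → select fs g ⊆ select fs f → ∀ i → f i ≡ g i
  select-injective (s ∷ fs) f g un f⊆g g⊆f = go
    where
    u-s = proj₁ (unique-++⁻ (Exchange.support s) un)
    u-fs = proj₁ (proj₂ (unique-++⁻ (Exchange.support s) un))
    apart = proj₂ (proj₂ (unique-++⁻ (Exchange.support s) un))
    sides-disjoint : ∀ {a} → a ∈ Exchange.S s → a ∉ Exchange.T s
    sides-disjoint = proj₂ (proj₂ (unique-++⁻ (Exchange.S s) u-s))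
    head⊆ : ∀ f g → select (s ∷ fs) f ⊆ select (s ∷ fs) g → side s (f fzero) ⊆ side s (g fzero)
    head⊆ f g sub a∈ with ∈-++⁻ (side s (g fzero)) (sub (∈-++⁺ˡ a∈))
    ... | inj₁ a∈g = a∈g
    ... | inj₂ a∈fs = ⊥-elim (apart (side⊆support s (f fzero) a∈) (select⊆supports fs (g ∘ fsuc) a∈fs))
    tail⊆ : ∀ f g → select (s ∷ fs) f ⊆ select (s ∷ fs) g → select fs (f ∘ fsuc) ⊆ select fs (g ∘ fsuc)
    tail⊆ f g sub a∈ with ∈-++⁻ (side s (g fzero)) (sub (∈-++⁺ʳ (side s (f fzero)) a∈))
    ... | inj₁ a∈g = ⊥-elim (apart (side⊆support s (g fzero) a∈g) (select⊆supports fs (f ∘ fsuc) a∈))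
    ... | inj₂ a∈fs = a∈fs
    S⊈T : Exchange.S s ⊆ Exchange.T s → Exchange.T s ⊆ Exchange.S s → ⊥
    S⊈T S⊆T T⊆S with Exchange.nonempty s
    ... | a , a∈ with ∈-++⁻ (Exchange.S s) a∈
    ...   | inj₁ a∈S = sides-disjoint a∈S (S⊆T a∈S)
    ...   | inj₂ a∈T = sides-disjoint (T⊆S a∈T) a∈T
    go : ∀ i → f i ≡ g i
    go fzero with f fzero | g fzero | head⊆ f g f⊆g | head⊆ g f g⊆f
    ... | fzero | fzero | _ | _ = refl
    ... | fsuc fzero | fsuc fzero | _ | _ = refl
    ... | fzero | fsuc _ | f⊆ | g⊆ = ⊥-elim (S⊈T f⊆ g⊆)
    ... | fsuc _ | fzero | f⊆ | g⊆ = ⊥-elim (S⊈T g⊆ f⊆)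
    go (fsuc i) = select-injective fs (f ∘ fsuc) (g ∘ fsuc) u-fs (tail⊆ f g f⊆g) (tail⊆ g f g⊆f) i

funToFin-cong : ∀ {m n} {f g : Fin m → Fin n} → (∀ i → f i ≡ g i) → funToFin f ≡ funToFin g
funToFin-cong {zero} eq = refl
funToFin-cong {suc m} eq = cong₂ combine (eq fzero) (funToFin-cong (eq ∘ fsuc))

-- Choosing either side of every exchange gives products with the same large part, and the smooth parts take few values.
exchanges-few : ∀ {n} (A w u : Fin n → ℕ) → (∀ i → A i ≡ w i * u i) → DistinctSubsetProducts A →
                ∀ {T J} → (∀ i → Smooth T J (u i)) → (fs : List (Exchange w)) → Unique (supports fs) →
                2 ^ length fs ≤ suc (n * J) ^ T
exchanges-few {n} A w u A≡ distinct {T} {J} smooth fs un = Fin.injective⇒≤ {f = code} code-injective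
  where
  Choice = Fin (2 ^ length fs)
  chosen : Choice → List (Fin n)
  chosen = select fs ∘ finToFun
  unique : ∀ a → Unique (chosen a)
  unique a = select-unique fs (finToFun a) un
  -- A choice repeats no index, so it has at most n elements and its exponents are at most n * J.
  smooth-chosen : ∀ a → Smooth T (n * J) (prodOver u (chosen a))
  smooth-chosen a = smooth-mono (*-monoˡ-≤ J (≤-trans (length-⊆ {m = allFin n} (unique a) λ {i} _ → ∈-allFin i) (≤-reflexive (length-tabulate {n = n} id))))
                                (smooth-prod u smooth (chosen a))
  module Chosen a = Smooth (smooth-chosen a)
  open Chosen using (exponent)
  digit : Choice → Fin T → Fin (suc (n * J))
  digit a j = fromℕ< (s≤s (Chosen.bounded a (suc (toℕ j))))
  toℕ-digit : ∀ a j → toℕ (digit a j) ≡ exponent a (suc (toℕ j))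
  toℕ-digit a j = Fin.toℕ-fromℕ< (s≤s (Chosen.bounded a (suc (toℕ j))))
  -- The exponents of the smooth part, T digits in base n * J + 1. The code determines the smooth
  -- part, and the large part is the same for all choices.
  code : Choice → Fin (suc (n * J) ^ T)
  code = funToFin ∘ digit
  code-injective : ∀ {a b} → code a ≡ code b → a ≡ b
  code-injective {a} {b} eq = begin
    a                                    ≡⟨ Fin.funToFin-finToFin {length fs} a ⟨
    funToFin (finToFun {2} {length fs} a) ≡⟨ funToFin-cong same-choice ⟩
    funToFin (finToFun {2} {length fs} b) ≡⟨ Fin.funToFin-finToFin {length fs} b ⟩
    b                                    ∎
    where
    open ≡-Reasoning
    same-digit : ∀ j → digit a j ≡ digit b j
    same-digit j = trans (sym (Fin.finToFun-funToFin (digit a) j))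
                     (trans (cong (λ c → finToFun {suc (n * J)} {T} c j) eq) (Fin.finToFun-funToFin (digit b) j))
    same-exponent : ∀ j → j < T → exponent a (suc j) ≡ exponent b (suc j)
    same-exponent j j<T = subst (λ i → exponent a (suc i) ≡ exponent b (suc i)) (Fin.toℕ-fromℕ< j<T)
      (trans (sym (toℕ-digit a (fromℕ< j<T))) (trans (cong toℕ (same-digit (fromℕ< j<T))) (toℕ-digit b (fromℕ< j<T))))
    same-u : prodOver u (chosen a) ≡ prodOver u (chosen b)
    same-u = trans (Chosen.factored a) (trans (powers-cong T same-exponent) (sym (Chosen.factored b)))
    prodA : ∀ l → prodOver A l ≡ prodOver w l * prodOver u l
    prodA l = trans (cong product (map-cong A≡ l)) (prodOver-* w u l)
    same-subset : toSubset (chosen a) ≡ toSubset (chosen b)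
    same-subset = distinct _ _ (begin
      subsetProd A (toSubset (chosen a))               ≡⟨ subsetProd-toSubset A (unique a) ⟩
      prodOver A (chosen a)                            ≡⟨ prodA (chosen a) ⟩
      prodOver w (chosen a) * prodOver u (chosen a)    ≡⟨ cong₂ _*_ (select-balanced fs (finToFun a) (finToFun b)) same-u ⟩
      prodOver w (chosen b) * prodOver u (chosen b)    ≡⟨ prodA (chosen b) ⟨
      prodOver A (chosen b)                            ≡⟨ subsetProd-toSubset A (unique b) ⟨
      subsetProd A (toSubset (chosen b))               ∎)
    chosen⊆ : ∀ {a b} → toSubset (chosen a) ≡ toSubset (chosen b) → chosen a ⊆ chosen b
    chosen⊆ {a} {b} same {i} i∈ = toSubset⇒∈ (chosen b) (trans (cong (λ s → Vec.lookup s i) (sym same)) (∈⇒toSubset i∈))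
    same-choice : ∀ i → finToFun {2} {length fs} a i ≡ finToFun {2} {length fs} b i
    same-choice = select-injective fs (finToFun a) (finToFun b) un (chosen⊆ {a} {b} same-subset) (chosen⊆ {b} {a} (sym same-subset))

-- Large prime factors

-- A greedy matching of elements with equal `f`. Each pair is an exchange for the weight `f`, and on
-- what remains `f` is injective.
record PairedUp {A : Set} (f : A → ℕ) (l : List A) : Set where
  field
    pairs    : List (Exchange f)
    single   : List A
    perm     : supports pairs ++ single ↭ l
    twice    : length (supports pairs) ≡ 2 * length pairs
    distinct : ∀ {a b} → a ∈ single → b ∈ single → f a ≡ f b → a ≡ b

pairUp : ∀ {A : Set} (f : A → ℕ) l → PairedUp f l
pairUp f [] = record { pairs = [] ; single = [] ; perm = ↭-refl ; twice = refl ; distinct = λ () }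
pairUp f (a ∷ l) with pairUp f l
... | P with Any.any? (λ b → f a ≟ f b) (PairedUp.single P)
...   | no fresh = record
  { pairs = pairs ; single = a ∷ single ; perm = ↭-trans (shift a (supports pairs) single) (↭-prep a perm) ; twice = twice
  ; distinct = λ { (here refl) (here refl) eq → refl
                 ; (here refl) (there b∈) eq → ⊥-elim (fresh (lose b∈ eq))
                 ; (there a∈) (here refl) eq → ⊥-elim (fresh (lose a∈ (sym eq)))
                 ; (there a∈) (there b∈) eq → distinct a∈ b∈ eq } }
  where open PairedUp P
...   | yes hit with find hit
...     | b , b∈ , fa≡fb with ∈-∃++ b∈
...       | l₁ , l₂ , single≡ = record
  { pairs = record { S = a ∷ [] ; T = b ∷ [] ; nonempty = a , here refl ; balanced = cong (_* 1) fa≡fb } ∷ pairs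
  ; single = l₁ ++ l₂
  ; perm = ↭-prep a (↭-trans (↭-sym moved) (↭-trans (↭-reflexive (cong (supports pairs ++_) (sym single≡))) perm))
  ; twice = trans (cong (suc ∘ suc) twice) (sym (*-suc 2 (length pairs)))
  ; distinct = λ a∈ b∈ → distinct (subst (_ ∈_) (sym single≡) (∈-expand l₁ a∈)) (subst (_ ∈_) (sym single≡) (∈-expand l₁ b∈)) }
  where
  open PairedUp P
  moved : supports pairs ++ l₁ ++ b ∷ l₂ ↭ b ∷ supports pairs ++ l₁ ++ l₂
  moved = ↭-trans (++⁺ˡ (supports pairs) (shift b l₁ l₂)) (shift b (supports pairs) (l₁ ++ l₂))

OneOrPrime : ℕ → ℕ → Set
OneOrPrime T x = x ≡ 1 ⊎ (Prime x × T < x)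

oneOrPrime>0 : ∀ {T x} → OneOrPrime T x → 1 ≤ x
oneOrPrime>0 (inj₁ refl) = ≤-refl
oneOrPrime>0 (inj₂ (_ , T<x)) = ≤-trans (s≤s z≤n) T<x

-- `smooth` covers all larger thresholds because `u` is used twice: at T, where x * y is the large
-- part, and at T′, where x alone is.
record Split (T J a : ℕ) : Set where
  field
    x y u  : ℕ
    a≡     : a ≡ x * y * u
    y≤x    : y ≤ x
    x-big  : OneOrPrime T x
    y-big  : OneOrPrime T y
    smooth : ∀ {T′} → T ≤ T′ → Smooth T′ J u

record Sieved (T : ℕ) (l : List ℕ) : Set where
  field
    big      : List ℕ
    rest     : ℕ
    product≡ : product l ≡ product big * rest
    allBig   : All (λ p → Prime p × T < p) big
    smooth   : ∀ {T′} → T ≤ T′ → Smooth T′ (length l) rest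
    rest>0   : 1 ≤ rest

prime>1 : ∀ {p} → Prime p → 2 ≤ p
prime>1 {p} pr = nonTrivial⇒n>1 p {{prime⇒nonTrivial pr}}

sieve : ∀ T l → All Prime l → Sieved T l
sieve T [] [] = record { big = [] ; rest = 1 ; product≡ = refl ; allBig = [] ; smooth = λ _ → smooth-1 ; rest>0 = ≤-refl }
sieve T (p ∷ l) (pr ∷ prs) with sieve T l prs | T <? p
... | V | yes T<p = record
  { big = p ∷ big ; rest = rest
  ; product≡ = trans (cong (p *_) product≡) (sym (*-assoc p (product big) rest))
  ; allBig = (pr , T<p) ∷ allBig
  ; smooth = smooth-mono (n≤1+n _) ∘ smooth
  ; rest>0 = rest>0 }
  where open Sieved V
... | V | no T≮p = record
  { big = big ; rest = p * rest
  ; product≡ = trans (cong (p *_) product≡) (x∙yz≈y∙xz p (product big) rest)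
  ; allBig = allBig
  ; smooth = λ T≤T′ → smooth-* (smooth-≤ (<⇒≤ (prime>1 pr)) (≤-trans (≮⇒≥ T≮p) T≤T′)) (smooth T≤T′)
  ; rest>0 = *-mono-≤ (<⇒≤ (prime>1 pr)) rest>0 }
  where open Sieved V

2^length≤product : ∀ {l} → All Prime l → 2 ^ length l ≤ product l
2^length≤product [] = ≤-refl
2^length≤product (pr ∷ prs) = *-mono-≤ (prime>1 pr) (2^length≤product prs)

2^-cancel-< : ∀ {m n} → 2 ^ m < 2 ^ n → m < n
2^-cancel-< {m} {n} lt = ≰⇒> λ n≤m → <⇒≱ lt (^-monoʳ-≤ 2 n≤m)

2^-cancel-≤ : ∀ {m n} → 2 ^ m ≤ 2 ^ n → m ≤ n
2^-cancel-≤ {m} {n} le = ≮⇒≥ λ n<m → <⇒≱ (^-monoʳ-< 2 ≤-refl n<m) le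

-- Three prime factors above T would give a ≥ T³ > N. The exponents of the rest are bounded by the
-- number of prime factors, which is at most ℓ since each is at least 2.
split : ∀ {N T ℓ a} → 1 ≤ a → a ≤ N → N < T * T * T → N < 2 ^ ℓ → Split T ℓ a
split {N} {T} {ℓ} {a} a>0 a≤N N<T³ N<2^ℓ = go big allBig product≡
  where
  open PrimeFactorisation (factorise a {{>-nonZero a>0}}) using (isFactorisation; factorsPrime) renaming (factors to ps)
  open Sieved (sieve T ps factorsPrime)
  len : length ps ≤ ℓ
  len = <⇒≤ (2^-cancel-< (≤-<-trans (2^length≤product factorsPrime)
          (≤-<-trans (≤-trans (≤-reflexive (sym isFactorisation)) a≤N) N<2^ℓ)))
  smooth′ : ∀ {T′} → T ≤ T′ → Smooth T′ ℓ rest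
  smooth′ = smooth-mono len ∘ smooth
  go : ∀ big → All (λ p → Prime p × T < p) big → product ps ≡ product big * rest → Split T ℓ a
  go [] [] eq = record { x = 1 ; y = 1 ; u = rest ; a≡ = trans isFactorisation eq ; y≤x = ≤-refl
                       ; x-big = inj₁ refl ; y-big = inj₁ refl ; smooth = smooth′ }
  go (p ∷ []) (hp ∷ []) eq = record { x = p ; y = 1 ; u = rest ; a≡ = trans isFactorisation eq ; y≤x = <⇒≤ (prime>1 (proj₁ hp))
                       ; x-big = inj₂ hp ; y-big = inj₁ refl ; smooth = smooth′ }
  go (p ∷ q ∷ []) (hp ∷ hq ∷ []) eq with ≤-total q p
  ... | inj₁ q≤p = record { x = p ; y = q ; u = rest ; a≡ = trans isFactorisation (trans eq (cong (λ s → p * s * rest) (*-identityʳ q)))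
                          ; y≤x = q≤p ; x-big = inj₂ hp ; y-big = inj₂ hq ; smooth = smooth′ }
  ... | inj₂ p≤q = record { x = q ; y = p ; u = rest
                          ; a≡ = trans isFactorisation (trans eq (cong (_* rest) (trans (cong (p *_) (*-identityʳ q)) (*-comm p q))))
                          ; y≤x = p≤q ; x-big = inj₂ hq ; y-big = inj₂ hp ; smooth = smooth′ }
  go (p ∷ q ∷ s ∷ big) ((pp , T<p) ∷ (pq , T<q) ∷ (ps′ , T<s) ∷ hs) eq = ⊥-elim (<⇒≱ N<T³ (begin
    T * T * T                                  ≤⟨ *-mono-≤ (*-mono-≤ (<⇒≤ T<p) (<⇒≤ T<q)) (<⇒≤ T<s) ⟩
    p * q * s                                  ≤⟨ m≤m*n (p * q * s) (product big * rest) {{>-nonZero (*-mono-≤ (bigs>0 hs) rest>0)}} ⟩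
    p * q * s * (product big * rest)           ≡⟨ arith p q s (product big) rest ⟩
    p * (q * (s * product big)) * rest         ≡⟨ trans isFactorisation eq ⟨
    a                                          ≤⟨ a≤N ⟩
    N                                          ∎))
    where
    open ≤-Reasoning
    arith : ∀ p q s b r → p * q * s * (b * r) ≡ p * (q * (s * b)) * r
    arith = solve-∀
    bigs>0 : ∀ {bs} → All (λ p → Prime p × T < p) bs → 1 ≤ product bs
    bigs>0 [] = ≤-refl
    bigs>0 (h ∷ hs) = *-mono-≤ (<⇒≤ (prime>1 (proj₁ h))) (bigs>0 hs)

-- The multigraph of a set with distinct subset products

n<2^n : ∀ n → n < 2 ^ n
n<2^n zero = ≤-refl
n<2^n (suc n) = ≤-trans (+-mono-≤ (m^n>0 2 n) (n<2^n n)) (≤-reflexive (cong (2 ^ n +_) (sym (+-identityʳ (2 ^ n)))))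

^-distribʳ-* : ∀ m n k → (m * n) ^ k ≡ m ^ k * n ^ k
^-distribʳ-* m n zero = refl
^-distribʳ-* m n (suc k) rewrite ^-distribʳ-* m n k = *-interchange m n (m ^ k) (n ^ k)

-- Bernoulli's inequality for (1 + 1/k)^j, multiplied by k^(j + 1).
bernoulli : ∀ k j → k ^ j * (k + j) ≤ k * suc k ^ j
bernoulli k zero = ≤-reflexive (trans (*-identityˡ _) (trans (+-identityʳ k) (sym (*-identityʳ k))))
bernoulli k (suc j) = begin
  k * k ^ j * (k + suc j)      ≤⟨ m≤m+n _ (k ^ j * j) ⟩
  k * k ^ j * (k + suc j) + k ^ j * j ≡⟨ arith k (k ^ j) j ⟩
  suc k * (k ^ j * (k + j))    ≤⟨ *-monoʳ-≤ (suc k) (bernoulli k j) ⟩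
  suc k * (k * suc k ^ j)      ≡⟨ x∙yz≈y∙xz (suc k) k (suc k ^ j) ⟩
  k * (suc k * suc k ^ j)      ∎
  where
  open ≤-Reasoning
  arith : ∀ k p j → k * p * (k + suc j) + p * j ≡ suc k * (p * (k + j))
  arith = solve-∀

-- By `bernoulli` with j = k, every k layers double the ball; ℓ + 1 doublings exceed m + 1.
radius-enough : ∀ k ℓ m → 1 ≤ k → m < 2 ^ ℓ → k ^ (k * suc ℓ) * suc m < suc k ^ (k * suc ℓ)
radius-enough k ℓ m k>0 m<2^ℓ = begin-strict
  k ^ (k * suc ℓ) * suc m          <⟨ *-monoʳ-< (k ^ (k * suc ℓ)) {{m^n≢0 k (k * suc ℓ)}} (≤-<-trans m<2^ℓ (^-monoʳ-< 2 ≤-refl (n<1+n ℓ))) ⟩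
  k ^ (k * suc ℓ) * 2 ^ suc ℓ      ≡⟨ cong (_* 2 ^ suc ℓ) (^-*-assoc k k (suc ℓ)) ⟨
  (k ^ k) ^ suc ℓ * 2 ^ suc ℓ      ≡⟨ ^-distribʳ-* (k ^ k) 2 (suc ℓ) ⟨
  (k ^ k * 2) ^ suc ℓ              ≤⟨ ^-monoˡ-≤ (suc ℓ) doubling ⟩
  (suc k ^ k) ^ suc ℓ              ≡⟨ ^-*-assoc (suc k) k (suc ℓ) ⟩
  suc k ^ (k * suc ℓ)              ∎
  where
  open ≤-Reasoning
  instance
    k≢0 = >-nonZero k>0
  doubling : k ^ k * 2 ≤ suc k ^ k
  doubling = *-cancelˡ-≤ k (≤-trans (≤-reflexive (arith k (k ^ k))) (bernoulli k k))
    where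
    arith : ∀ k p → k * (p * 2) ≡ p * (k + k)
    arith = solve-∀

-- The base is at most (n + 1) * (ℓ + 1), and each factor is at most 2 ^ ℓ. The slack in J admits
-- both J = ℓ for `u` and J = ℓ + 1 for y * u.
logarithmic : ∀ {m n J T ℓ} → 2 ^ m ≤ suc (n * J) ^ T → n < 2 ^ ℓ → J ≤ suc ℓ → m ≤ (ℓ + ℓ) * T
logarithmic {m} {n} {J} {T} {ℓ} le n<2^ℓ J≤ = 2^-cancel-≤ (begin
  2 ^ m                  ≤⟨ le ⟩
  suc (n * J) ^ T        ≤⟨ ^-monoˡ-≤ T (s≤s (*-monoʳ-≤ n J≤)) ⟩
  suc (n * suc ℓ) ^ T    ≤⟨ ^-monoˡ-≤ T (s≤s (m≤n+m (n * suc ℓ) ℓ)) ⟩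
  (suc n * suc ℓ) ^ T    ≤⟨ ^-monoˡ-≤ T (*-mono-≤ n<2^ℓ (n<2^n ℓ)) ⟩
  (2 ^ ℓ * 2 ^ ℓ) ^ T    ≡⟨ cong (_^ T) (^-distribˡ-+-* 2 ℓ ℓ) ⟨
  (2 ^ (ℓ + ℓ)) ^ T      ≡⟨ ^-*-assoc 2 (ℓ + ℓ) T ⟩
  2 ^ ((ℓ + ℓ) * T)      ∎)
  where open ≤-Reasoning

unique-map : ∀ {A B : Set} (f : A → B) {l} → Unique l → (∀ {a b} → a ∈ l → b ∈ l → f a ≡ f b → a ≡ b) → Unique (map f l)
unique-map f {[]} [] inj = []
unique-map f {a ∷ l} un@(_ ∷ un′) inj = unique-∷ fresh (unique-map f un′ λ a∈ b∈ → inj (there a∈) (there b∈))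
  where
  fresh : f a ∉ map f l
  fresh fa∈ with ∈-map⁻ f fa∈
  ... | b , b∈ , eq with refl ← inj (here refl) (there b∈) eq = Unique[x∷xs]⇒x∉xs un b∈

ind : ∀ {P : Set} → Dec P → ℕ
ind d = if does d then 1 else 0

ind-true : ∀ {P : Set} (d : Dec P) → P → ind d ≡ 1
ind-true d p rewrite dec-true d p = refl

sumOver-ind : ∀ {A : Set} {P : A → Set} (P? : ∀ a → Dec (P a)) l → sumOver (ind ∘ P?) l ≡ length (filter P? l)
sumOver-ind P? [] = refl
sumOver-ind P? (a ∷ l) with does (P? a)
... | true = cong suc (sumOver-ind P? l)
... | false = sumOver-ind P? l

-- Here p counts the pendants, q the core edges and k the core primes. The constant 4 is the share
-- of the vertex 1: two units as a vertex of a tree and two in the weight `c`.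
sum-up : ∀ {n} p q {L f m C W k π r s} → n ≡ p + q → 2 * q ≤ 2 * (L * f) + (2 * C + W) → f ≤ m →
          W ≤ 2 * suc k + (2 + (r + s)) → p + k ≤ π → 2 * n ≤ 2 * (L * m) + (2 * C + 4) + (2 * π + r + s)
sum-up p q {L} {f} {m} {C} {W} {k} {π} {r} {s} refl q≤ f≤m W≤ p+k≤π = begin
  2 * (p + q)                                                            ≡⟨ *-distribˡ-+ 2 p q ⟩
  2 * p + 2 * q                                                          ≤⟨ +-monoʳ-≤ (2 * p) q≤ ⟩
  2 * p + (2 * (L * f) + (2 * C + W))                                    ≤⟨ +-monoʳ-≤ (2 * p) (+-mono-≤ (*-monoʳ-≤ 2 (*-monoʳ-≤ L f≤m)) (+-monoʳ-≤ (2 * C) W≤)) ⟩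
  2 * p + (2 * (L * m) + (2 * C + (2 * suc k + (2 + (r + s)))))          ≡⟨ arith p (L * m) C k r s ⟩
  2 * (L * m) + (2 * C + 4) + (2 * (p + k) + r + s)                      ≤⟨ +-monoʳ-≤ (2 * (L * m) + (2 * C + 4)) (+-monoˡ-≤ s (+-monoˡ-≤ r (*-monoʳ-≤ 2 p+k≤π))) ⟩
  2 * (L * m) + (2 * C + 4) + (2 * π + r + s)                            ∎
  where
  open ≤-Reasoning
  arith : ∀ p q C k r s → 2 * p + (2 * q + (2 * C + (2 * suc k + (2 + (r + s))))) ≡ 2 * q + (2 * C + 4) + (2 * (p + k) + r + s)
  arith = solve-∀

-- Two odd cycles, each of at most 2R + 1 edges, in a tree of depth R.
trailLength : ℕ → ℕ
trailLength R = suc (R + R) + suc (R + R)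

module Decomposed {N n : ℕ} (A : Fin n → ℕ) (range : SubsetOfRange N A) (products : DistinctSubsetProducts A)
                  {t ℓ T T′ : ℕ} (t>0 : 1 ≤ t) (N>0 : 1 ≤ N) (T≤T′ : T ≤ T′)
                  (N<T³ : N < T * T * T) (N<T′² : N < T′ * T′) (N<2^ℓ : N < 2 ^ ℓ) where

  part : ∀ i → Split T ℓ (A i)
  part i = split (proj₁ (proj₂ range i)) (proj₂ (proj₂ range i)) N<T³ N<2^ℓ

  module Part i = Split (part i)
  open Part using (x; y; u)

  x>0 : ∀ i → 1 ≤ x i
  x>0 i = oneOrPrime>0 (Part.x-big i)

  y>0 : ∀ i → 1 ≤ y i
  y>0 i = oneOrPrime>0 (Part.y-big i)

  A>0 : ∀ i → 1 ≤ A i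
  A>0 i = proj₁ (proj₂ range i)

  A≤N : ∀ i → A i ≤ N
  A≤N i = proj₂ (proj₂ range i)

  xy≤N : ∀ i → x i * y i ≤ N
  xy≤N i = ≤-trans (∣⇒≤ {{>-nonZero (A>0 i)}} (divides (u i) (trans (Part.a≡ i) (*-comm _ (u i))))) (A≤N i)

  x≤N : ∀ i → x i ≤ N
  x≤N i = ≤-trans (m≤m*n (x i) (y i) {{>-nonZero (y>0 i)}}) (xy≤N i)

  y≤N : ∀ i → y i ≤ N
  y≤N i = ≤-trans (Part.y≤x i) (x≤N i)

  y²≤N : ∀ i → y i * y i ≤ N
  y²≤N i = ≤-trans (*-monoˡ-≤ (y i) (Part.y≤x i)) (xy≤N i)

  y≤T′ : ∀ i → y i ≤ T′
  y≤T′ i = ≮⇒≥ λ T′<y → <⇒≱ N<T′² (≤-trans (*-mono-≤ (<⇒≤ T′<y) (<⇒≤ T′<y)) (y²≤N i))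

  n≤N : n ≤ N
  n≤N = begin
    n                           ≡⟨ trans (length-map A (allFin n)) (length-tabulate {n = n} id) ⟨
    length (map A (allFin n))   ≤⟨ length-⊆ (Unique.map⁺ (proj₁ range) (Unique.allFin⁺ n)) values ⟩
    length (map suc (upTo N))   ≡⟨ trans (length-map suc (upTo N)) (length-upTo N) ⟩
    N                           ∎
    where
    open ≤-Reasoning
    values : map A (allFin n) ⊆ map suc (upTo N)
    values a∈ with ∈-map⁻ A a∈
    ... | i , _ , refl = subst (_∈ map suc (upTo N)) (suc-pred (A i) {{>-nonZero (A>0 i)}})
          (∈-map⁺ suc (∈-upTo⁺ (subst (_≤ N) (sym (suc-pred (A i) {{>-nonZero (A>0 i)}})) (A≤N i))))

  n<2^ℓ : n < 2 ^ ℓ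
  n<2^ℓ = ≤-<-trans n≤N N<2^ℓ

  open PairedUp (pairUp x (allFin n))

  pairs-unique : Unique (supports pairs ++ single)
  pairs-unique = unique-resp-↭ (↭-sym perm) (Unique.allFin⁺ n)

  -- Only x is taken as the large part. Since y² ≤ N < T′², the factor y is at most T′ and goes into
  -- the smooth part, at the price of one more in the exponent.
  pairs-few : length pairs ≤ (ℓ + ℓ) * T′
  pairs-few = logarithmic {n = n} {J = suc ℓ} {T = T′} (exchanges-few A x (λ i → y i * u i) (λ i → trans (Part.a≡ i) (*-assoc (x i) (y i) (u i))) products
                (λ i → smooth-* {J = 1} {K = ℓ} (smooth-≤ (y>0 i) (y≤T′ i)) (Part.smooth i T≤T′)) pairs (proj₁ (unique-++⁻ (supports pairs) pairs-unique)))
                n<2^ℓ ≤-refl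

  -- For `i` in `single` this makes x i a vertex of degree one: no paired element has it as x, no
  -- other single element does, and it is too large to be any y.
  Pendant : Fin n → Set
  Pendant i = T′ < x i × x i ∉ map x (supports pairs)

  pendant? : ∀ i → Dec (Pendant i)
  pendant? i = (T′ <? x i) ×-dec ¬? (x i ∈ℕ? map x (supports pairs))

  pendants attached core : List (Fin n)
  pendants = filter pendant? single
  attached = filter (¬? ∘ pendant?) single
  core = supports pairs ++ attached

  single-unique : Unique single
  single-unique = proj₁ (proj₂ (unique-++⁻ (supports pairs) pairs-unique))

  core-unique : Unique core
  core-unique with unique-++⁻ (supports pairs) pairs-unique
  ... | up , us , apart = Unique.++⁺ up (Unique.filter⁺ (¬? ∘ pendant?) us)
                            λ (i∈p , i∈a) → apart i∈p (proj₁ (∈-filter⁻ (¬? ∘ pendant?) i∈a))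

  n≡ : n ≡ length pendants + length core
  n≡ = begin
    n                                                                 ≡⟨ length-tabulate {n = n} id ⟨
    length (allFin n)                                                 ≡⟨ ↭-length perm ⟨
    length (supports pairs ++ single)                                 ≡⟨ length-++ (supports pairs) ⟩
    length (supports pairs) + length single                           ≡⟨ cong (length (supports pairs) +_) (length-filter-+ pendant? single) ⟨
    length (supports pairs) + (length pendants + length attached)     ≡⟨ +x∙yz≈y∙xz (length (supports pairs)) (length pendants) (length attached) ⟩
    length pendants + (length (supports pairs) + length attached)     ≡⟨ cong (length pendants +_) (length-++ (supports pairs)) ⟨
    length pendants + length core                                     ∎
    where open ≡-Reasoning

  -- On `attached` the map x is injective, with values either among the T′ + 1 numbers from 0 to T′
  -- or among the x of the paired elements. The latter number twice the pairs, and the pairs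
  -- themselves are in the core as well.
  core-few : length core ≤ 4 * ((ℓ + ℓ) * T′) + suc T′
  core-few = begin
    length core                                                          ≡⟨ length-++ (supports pairs) ⟩
    length (supports pairs) + length attached                            ≤⟨ +-monoʳ-≤ (length (supports pairs)) attached-few ⟩
    length (supports pairs) + (suc T′ + length (supports pairs))         ≡⟨ cong₂ (λ p q → p + (suc T′ + q)) twice twice ⟩
    2 * length pairs + (suc T′ + 2 * length pairs)                       ≡⟨ arith (length pairs) (suc T′) ⟩
    4 * length pairs + suc T′                                            ≤⟨ +-monoˡ-≤ (suc T′) (*-monoʳ-≤ 4 pairs-few) ⟩
    4 * ((ℓ + ℓ) * T′) + suc T′                                          ∎
    where
    open ≤-Reasoning
    arith : ∀ p q → 2 * p + (q + 2 * p) ≡ 4 * p + q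
    arith = solve-∀
    xs-attached⊆ : map x attached ⊆ upTo (suc T′) ++ map x (supports pairs)
    xs-attached⊆ x∈ with ∈-map⁻ x x∈
    ... | i , i∈ , refl with ∈-filter⁻ (¬? ∘ pendant?) {xs = single} i∈ | T′ <? x i | x i ∈ℕ? map x (supports pairs)
    ...   | _ , _ | _ | yes xi∈ = ∈-++⁺ʳ (upTo (suc T′)) xi∈
    ...   | _ , _ | no T′≮x | _ = ∈-++⁺ˡ (∈-upTo⁺ (s≤s (≮⇒≥ T′≮x)))
    ...   | _ , not | yes T′<x | no xi∉ = ⊥-elim (not (T′<x , xi∉))
    attached-few : length attached ≤ suc T′ + length (supports pairs)
    attached-few = begin
      length attached                                       ≡⟨ length-map x attached ⟨
      length (map x attached)                               ≤⟨ length-⊆ (unique-map x (Unique.filter⁺ (¬? ∘ pendant?) single-unique)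
                                                                 λ a∈ b∈ → distinct (proj₁ (∈-filter⁻ (¬? ∘ pendant?) a∈)) (proj₁ (∈-filter⁻ (¬? ∘ pendant?) b∈))) xs-attached⊆ ⟩
      length (upTo (suc T′) ++ map x (supports pairs))      ≡⟨ length-++ (upTo (suc T′)) ⟩
      length (upTo (suc T′)) + length (map x (supports pairs)) ≡⟨ cong₂ _+_ (length-upTo (suc T′)) (length-map x (supports pairs)) ⟩
      suc T′ + length (supports pairs)                      ∎

  -- Primes owned by pendants are left out, so that in `primes-enough` pendants and vertices draw on
  -- disjoint sets of primes.
  CorePrime : ℕ → Set
  CorePrime p = Prime p × T < p × p ∉ map x pendants

  corePrime? : ∀ p → Dec (CorePrime p)
  corePrime? p = prime? p ×-dec ((T <? p) ×-dec ¬? (p ∈ℕ? map x pendants))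

  corePrimes vertices : List ℕ
  corePrimes = filter corePrime? (upTo (suc N))
  vertices = 1 ∷ corePrimes

  corePrimes⇒ : ∀ {p} → p ∈ corePrimes → p < suc N × CorePrime p
  corePrimes⇒ p∈ with ∈-filter⁻ corePrime? {xs = upTo (suc N)} p∈
  ... | p∈u , cp = ∈-upTo⁻ p∈u , cp

  corePrimes-unique : Unique corePrimes
  corePrimes-unique = Unique.filter⁺ corePrime? (Unique.upTo⁺ (suc N))

  vertices-unique : Unique vertices
  vertices-unique = unique-∷ (λ 1∈ → ¬prime[1] (proj₁ (proj₂ (corePrimes⇒ 1∈)))) corePrimes-unique

  core⇒ : ∀ {i j} → i ∈ core → j ∈ pendants → x i ≢ x j
  core⇒ {i} {j} i∈ j∈ eq with ∈-++⁻ (supports pairs) i∈ | ∈-filter⁻ pendant? {xs = single} j∈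
  ... | inj₁ i∈p | _ , (_ , xj∉) = xj∉ (subst (_∈ map x (supports pairs)) eq (∈-map⁺ x i∈p))
  ... | inj₂ i∈a | j∈s , pj with ∈-filter⁻ (¬? ∘ pendant?) {xs = single} i∈a
  ...   | i∈s , not-pi with refl ← distinct i∈s j∈s eq = not-pi pj

  ends : ∀ {i} → i ∈ core → x i ∈ vertices × y i ∈ vertices
  ends {i} i∈ = x-end , y-end
    where
    x-end : x i ∈ vertices
    x-end with Part.x-big i
    ... | inj₁ x≡1 = here x≡1
    ... | inj₂ (pr , T<x) = there (∈-filter⁺ corePrime? (∈-upTo⁺ (s≤s (x≤N i))) (pr , T<x , λ xi∈ →
            let j , j∈ , eq = ∈-map⁻ x xi∈ in core⇒ i∈ j∈ eq))
    y-end : y i ∈ vertices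
    y-end with Part.y-big i
    ... | inj₁ y≡1 = here y≡1
    ... | inj₂ (pr , T<y) = there (∈-filter⁺ corePrime? (∈-upTo⁺ (s≤s (y≤N i))) (pr , T<y , λ yi∈ →
            let j , j∈ , eq = ∈-map⁻ x yi∈
                T′<xj , _ = proj₂ (∈-filter⁻ pendant? {xs = single} j∈) in <⇒≱ T′<xj (subst (_≤ T′) eq (y≤T′ i))))

  primes-enough : length pendants + length corePrimes ≤ primeCount N
  primes-enough = begin
    length pendants + length corePrimes          ≡⟨ cong (_+ length corePrimes) (length-map x pendants) ⟨
    length (map x pendants) + length corePrimes  ≡⟨ length-++ (map x pendants) ⟨
    length (map x pendants ++ corePrimes)        ≤⟨ length-⊆ (Unique.++⁺ xs-unique corePrimes-unique
                                                      λ (p∈x , p∈c) → proj₂ (proj₂ (proj₂ (corePrimes⇒ p∈c))) p∈x) sub ⟩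
    primeCount N                                 ∎
    where
    open ≤-Reasoning
    xs-unique : Unique (map x pendants)
    xs-unique = unique-map x (Unique.filter⁺ pendant? single-unique)
      λ a∈ b∈ → distinct (proj₁ (∈-filter⁻ pendant? a∈)) (proj₁ (∈-filter⁻ pendant? b∈))
    pendant-prime : ∀ {i} → i ∈ pendants → Prime (x i)
    pendant-prime {i} i∈ with Part.x-big i | ∈-filter⁻ pendant? {xs = single} i∈
    ... | inj₂ (pr , _) | _ = pr
    ... | inj₁ x≡1 | _ , (T′<x , _) = ⊥-elim (<⇒≱ (subst (T′ <_) x≡1 T′<x) (≤-trans (y>0 i) (y≤T′ i)))
    sub : map x pendants ++ corePrimes ⊆ filter prime? (upTo (suc N))
    sub p∈ with ∈-++⁻ (map x pendants) p∈
    ... | inj₂ p∈c = let p<N , pr , _ = corePrimes⇒ p∈c in ∈-filter⁺ prime? (∈-upTo⁺ p<N) pr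
    ... | inj₁ p∈x with ∈-map⁻ x p∈x
    ...   | i , i∈ , refl = ∈-filter⁺ prime? (∈-upTo⁺ (s≤s (x≤N i))) (pendant-prime i∈)

  module _ {R L : ℕ} (bound : trailLength R ≤ L) (few : t ^ R * suc (length core) < suc t ^ R)
           (small : ℕ → Bool) (small-end : ∀ i → small (x i) ≡ true ⊎ small (y i) ≡ true)
           (c : ℕ → ℕ) (c-small : ∀ {v} → small v ≡ true → 1 ≤ c v) (c-loop : ∀ {i} → x i ≡ y i → 2 ≤ c (x i))
           (sum-c : sumOver c vertices ≤ 2 + (primeCountSqrt N + squarePrimeCount N A)) where

    open BallGrowing Fin._≟_ x y x>0 y>0
    open Sparse small small-end c c-small c-loop t {R} {L} bound

    conclude : (∃[ fs ] Unique (supports {w = λ i → x i * y i} fs) × supports fs ⊆ core ×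
                ∃[ C ] t * C ≤ length core × 2 * length core ≤ 2 * (L * length fs) + (2 * C + sumOver weight vertices)) →
               ∃[ C ] t * C ≤ 4 * ((ℓ + ℓ) * T′) + suc T′ ×
               2 * n ≤ 2 * (L * ((ℓ + ℓ) * T)) + (2 * C + 4) + (2 * primeCount N + primeCountSqrt N + squarePrimeCount N A)
    conclude (fs , ufs , _ , C , tC≤ , core≤) = C , ≤-trans tC≤ core-few ,
      sum-up (length pendants) (length core) {L} {length fs} {(ℓ + ℓ) * T} {C} {sumOver weight vertices} {length corePrimes}
        {primeCount N} {primeCountSqrt N} {squarePrimeCount N A} n≡ core≤ trails-few weights primes-enough
      where
      trails-few : length fs ≤ (ℓ + ℓ) * T
      trails-few = logarithmic {n = n} {J = ℓ} {T = T}
        (exchanges-few A (λ i → x i * y i) u Part.a≡ products (λ i → Part.smooth i ≤-refl) fs ufs) n<2^ℓ (n≤1+n ℓ)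
      weights : sumOver weight vertices ≤ 2 * suc (length corePrimes) + (2 + (primeCountSqrt N + squarePrimeCount N A))
      weights = ≤-trans (≤-reflexive (sumOver-2+ c vertices))
                        (+-monoʳ-≤ (2 * suc (length corePrimes)) sum-c)

    weighted-deficit : ∃[ C ] t * C ≤ 4 * ((ℓ + ℓ) * T′) + suc T′ ×
      2 * n ≤ 2 * (L * ((ℓ + ℓ) * T)) + (2 * C + 4) + (2 * primeCount N + primeCountSqrt N + squarePrimeCount N A)
    weighted-deficit = conclude (exhaust vertices-unique (length core) core ≤-refl core-unique ends few)

  Small Square : ℕ → Set
  Small v = v * v ≤ N
  Square v = N < v * v * v × v * v ≤ N × ∃[ i ] v * v ∣ A i

  small? : ∀ v → Dec (Small v)
  small? v = v * v ≤? N

  square? : ∀ v → Dec (Square v)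
  square? v = (N <? v * v * v) ×-dec ((v * v ≤? N) ×-dec Fin.any? λ i → (v * v) ∣? A i)

  -- Over the primes among the vertices this sums to at most π(√N) + |P_□|. The vertex 1 gets a unit
  -- more because it may carry a loop, from an element with x = y = 1, while it never satisfies
  -- `Square`.
  c : ℕ → ℕ
  c v = ind (v ≟ 1) + (ind (small? v) + ind (square? v))

  c-small : ∀ {v} → does (small? v) ≡ true → 1 ≤ c v
  c-small {v} sm rewrite sm = ≤-trans (m≤m+n 1 _) (m≤n+m _ (ind (v ≟ 1)))

  -- A loop at a prime v > T means that v * v divides A i, and v³ ≥ T³ > N, so v belongs to P_□
  -- besides being small.
  c-loop : ∀ {i} → x i ≡ y i → 2 ≤ c (x i)
  c-loop {i} eq = heavy (Part.x-big i)
    where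
    v²≤N : x i * x i ≤ N
    v²≤N = subst (λ z → x i * z ≤ N) (sym eq) (xy≤N i)
    v²∣A : x i * x i ∣ A i
    v²∣A = subst (λ z → x i * z ∣ A i) (sym eq) (divides (u i) (trans (Part.a≡ i) (*-comm _ (u i))))
    heavy : OneOrPrime T (x i) → 2 ≤ c (x i)
    heavy (inj₁ x≡1) rewrite ind-true (x i ≟ 1) x≡1 | ind-true (small? (x i)) v²≤N = s≤s (s≤s z≤n)
    heavy (inj₂ (_ , T<x)) rewrite ind-true (small? (x i)) v²≤N
      | ind-true (square? (x i)) (<-≤-trans N<T³ (*-mono-≤ (*-mono-≤ (<⇒≤ T<x) (<⇒≤ T<x)) (<⇒≤ T<x)) , v²≤N , i , v²∣A)
      = m≤n+m 2 (ind (x i ≟ 1))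

  sum-c : sumOver c vertices ≤ 2 + (primeCountSqrt N + squarePrimeCount N A)
  sum-c = begin
    sumOver c vertices
      ≡⟨ trans (sumOver-+ (λ v → ind (v ≟ 1)) (λ v → ind (small? v) + ind (square? v)) vertices)
               (cong (sumOver (λ v → ind (v ≟ 1)) vertices +_) (sumOver-+ (ind ∘ small?) (ind ∘ square?) vertices)) ⟩
    sumOver (λ v → ind (v ≟ 1)) vertices + (sumOver (ind ∘ small?) vertices + sumOver (ind ∘ square?) vertices)
      ≡⟨ cong₂ _+_ (sumOver-ind (_≟ 1) vertices) (cong₂ _+_ (sumOver-ind small? vertices) (sumOver-ind square? vertices)) ⟩
    length (filter (_≟ 1) vertices) + (length (filter small? vertices) + length (filter square? vertices))
      ≤⟨ +-mono-≤ ones (+-mono-≤ smalls squares) ⟩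
    1 + (suc (primeCountSqrt N) + squarePrimeCount N A)
      ∎
    where
    open ≤-Reasoning
    ones : length (filter (_≟ 1) vertices) ≤ 1
    ones = length-⊆ {m = 1 ∷ []} (Unique.filter⁺ (_≟ 1) vertices-unique) λ v∈ → here (proj₂ (∈-filter⁻ (_≟ 1) {xs = vertices} v∈))
    smalls : length (filter small? vertices) ≤ suc (primeCountSqrt N)
    smalls = length-⊆ {m = 1 ∷ filter (λ p → prime? p ×-dec (p * p ≤? N)) (upTo (suc N))} (Unique.filter⁺ small? vertices-unique) sub
      where
      sub : filter small? vertices ⊆ 1 ∷ filter (λ p → prime? p ×-dec (p * p ≤? N)) (upTo (suc N))
      sub v∈ = let v∈V , sm = ∈-filter⁻ small? {xs = vertices} v∈ in go v∈V sm
        where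
        go : ∀ {v} → v ∈ vertices → Small v → v ∈ 1 ∷ filter (λ p → prime? p ×-dec (p * p ≤? N)) (upTo (suc N))
        go (here eq) _ = here eq
        go (there v∈c) sm = let v<N , pr , _ = corePrimes⇒ v∈c in
          there (∈-filter⁺ (λ p → prime? p ×-dec (p * p ≤? N)) (∈-upTo⁺ v<N) (pr , sm))
    squares : length (filter square? vertices) ≤ squarePrimeCount N A
    squares = length-⊆ (Unique.filter⁺ square? vertices-unique) sub
      where
      sub : filter square? vertices ⊆ filter (λ p → prime? p ×-dec square? p) (upTo (suc N))
      sub v∈ = let v∈V , sq = ∈-filter⁻ square? {xs = vertices} v∈ in go v∈V sq
        where
        go : ∀ {v} → v ∈ vertices → Square v → v ∈ filter (λ p → prime? p ×-dec square? p) (upTo (suc N))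
        go (here refl) (N<1 , _) = ⊥-elim (<⇒≱ N<1 N>0)
        go (there v∈c) sq = let v<N , pr , _ = corePrimes⇒ v∈c in
          ∈-filter⁺ (λ p → prime? p ×-dec square? p) (∈-upTo⁺ v<N) (pr , sq)

  deficit : ∃[ C ] t * C ≤ 4 * ((ℓ + ℓ) * T′) + suc T′ ×
            2 * n ≤ 2 * (trailLength (t * suc ℓ) * ((ℓ + ℓ) * T)) + (2 * C + 4)
                    + (2 * primeCount N + primeCountSqrt N + squarePrimeCount N A)
  deficit = weighted-deficit {t * suc ℓ} ≤-refl
    (radius-enough t ℓ (length core) t>0 (≤-<-trans (≤-trans (m≤n+m _ (length pendants)) (≤-reflexive (sym n≡))) n<2^ℓ))
    -- The small end is always y, since y ≤ x and x * y ≤ N.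
    (does ∘ small?) (λ i → inj₂ (dec-true (small? (y i)) (y²≤N i))) c (λ {v} → c-small {v}) (λ {i} → c-loop {i}) sum-c

-- Choice of parameters

root-floor : ∀ k .{{_ : NonZero k}} N → ∃[ t ] t ^ k ≤ N × N < suc t ^ k
root-floor k zero = 0 , ≤-reflexive (zero^ k) , m^n>0 1 k
  where
  zero^ : ∀ k .{{_ : NonZero k}} → 0 ^ k ≡ 0
  zero^ (suc k) = refl
root-floor k (suc N) with root-floor k N
... | t , t≤ , N< with suc N <? suc t ^ k
...   | yes N+1< = t , m≤n⇒m≤1+n t≤ , N+1<
...   | no N+1≮ = suc t , ≮⇒≥ N+1≮ , ≤-<-trans N< (^-monoˡ-< k (n<1+n (suc t)))

-- Here s = t + 1. Powers of s exceed the required thresholds strictly, and s ≤ 2 * t turns them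
-- into powers of t.
root-bracket : ∀ k .{{_ : NonZero k}} N → 1 ≤ N → ∃₂ λ t s → 1 ≤ t × s ≤ 2 * t × t ^ k ≤ N × N < s ^ k
root-bracket k N N>0 with root-floor k N
... | zero , _ , N<1 = ⊥-elim (<⇒≱ N<1 (≤-trans (≤-reflexive (^-zeroˡ k)) N>0))
... | suc t , t≤ , N< = suc t , suc (suc t) , s≤s z≤n , ≤-trans (s≤s (m≤n+m (suc t) t)) (≤-reflexive (cong (suc t +_) (sym (+-identityʳ (suc t))))) , t≤ , N<

log-ceil : ∀ N → 1 ≤ N → ∃[ ℓ ] 1 ≤ ℓ × N < 2 ^ ℓ × 2 ^ ℓ ≤ 2 * N
log-ceil (suc zero) _ = 1 , ≤-refl , ≤-refl , ≤-refl
log-ceil (suc (suc N)) _ with log-ceil (suc N) (s≤s z≤n)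
... | ℓ , ℓ>0 , N< , ≤2N with suc (suc N) <? 2 ^ ℓ
...   | yes N+1< = ℓ , ℓ>0 , N+1< , ≤-trans ≤2N (*-monoʳ-≤ 2 (n≤1+n (suc N)))
...   | no N+1≮ = suc ℓ , s≤s z≤n , ≤-<-trans N< (^-monoʳ-< 2 ≤-refl (n<1+n ℓ)) , *-monoʳ-≤ 2 (≮⇒≥ N+1≮)

-- This lets N^ε absorb the logarithms. With q the integer quotient of ℓ by k, ℓ ≤ k (q + 1) ≤ k
-- 2^q; the k-th power of this gives the claim.
power≤exponential : ∀ k .{{_ : NonZero k}} ℓ → ℓ ^ k ≤ k ^ k * 2 ^ ℓ
power≤exponential k ℓ = begin
  ℓ ^ k                          ≤⟨ ^-monoˡ-≤ k ℓ≤ ⟩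
  (k * 2 ^ (ℓ / k)) ^ k          ≡⟨ ^-distribʳ-* k (2 ^ (ℓ / k)) k ⟩
  k ^ k * (2 ^ (ℓ / k)) ^ k      ≡⟨ cong (k ^ k *_) (^-*-assoc 2 (ℓ / k) k) ⟩
  k ^ k * 2 ^ (ℓ / k * k)        ≤⟨ *-monoʳ-≤ (k ^ k) (^-monoʳ-≤ 2 (m/n*n≤m ℓ k)) ⟩
  k ^ k * 2 ^ ℓ                  ∎
  where
  open ≤-Reasoning
  ℓ≤ : ℓ ≤ k * 2 ^ (ℓ / k)
  ℓ≤ = begin
    ℓ                    ≡⟨ m≡m%n+[m/n]*n ℓ k ⟩
    ℓ % k + ℓ / k * k    ≤⟨ +-monoˡ-≤ (ℓ / k * k) (<⇒≤ (m%n<n ℓ k)) ⟩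
    suc (ℓ / k) * k      ≤⟨ *-monoˡ-≤ k (n<2^n (ℓ / k)) ⟩
    2 ^ (ℓ / k) * k      ≡⟨ *-comm (2 ^ (ℓ / k)) k ⟩
    k * 2 ^ (ℓ / k)      ∎

-- The cost of the exchanges: a length of at most 12 t ℓ times their number, at most 2 ℓ T. The
-- constant is 2 · 12 · 2 · 16.
trails-bound : ∀ {t ℓ T} → 1 ≤ t → 1 ≤ ℓ → T ≤ 16 * t ^ 4 → 2 * (trailLength (t * suc ℓ) * ((ℓ + ℓ) * T)) ≤ 768 * (t ^ 5 * ℓ ^ 2)
trails-bound {t} {ℓ} {T} t>0 ℓ>0 T≤ = begin
  2 * (trailLength (t * suc ℓ) * ((ℓ + ℓ) * T))                ≤⟨ *-monoʳ-≤ 2 (*-mono-≤ length≤ (*-monoʳ-≤ (ℓ + ℓ) T≤)) ⟩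
  2 * (12 * (t * ℓ) * ((ℓ + ℓ) * (16 * t ^ 4)))                ≡⟨ arith t ℓ (t ^ 4) ⟩
  768 * (t ^ 5 * ℓ ^ 2)                                        ∎
  where
  open ≤-Reasoning
  arith : ∀ t ℓ p → 2 * (12 * (t * ℓ) * ((ℓ + ℓ) * (16 * p))) ≡ 768 * (t * p * (ℓ * (ℓ * 1)))
  arith = solve-∀
  R≤ : t * suc ℓ ≤ 2 * (t * ℓ)
  R≤ = ≤-trans (*-monoʳ-≤ t (+-monoˡ-≤ ℓ ℓ>0)) (≤-reflexive (arith₁ t ℓ))
    where
    arith₁ : ∀ t ℓ → t * (ℓ + ℓ) ≡ 2 * (t * ℓ)
    arith₁ = solve-∀
  half≤ : suc (t * suc ℓ + t * suc ℓ) ≤ 6 * (t * ℓ)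
  half≤ = ≤-trans (+-mono-≤ (*-mono-≤ t>0 ℓ>0) (+-mono-≤ R≤ R≤)) (≤-trans (≤-reflexive (arith₂ (t * ℓ))) (*-monoˡ-≤ (t * ℓ) (n≤1+n 5)))
    where
    arith₂ : ∀ q → q + (2 * q + 2 * q) ≡ 5 * q
    arith₂ = solve-∀
  length≤ : trailLength (t * suc ℓ) ≤ 12 * (t * ℓ)
  length≤ = ≤-trans (+-mono-≤ half≤ half≤) (≤-reflexive (sym (*-distribʳ-+ (t * ℓ) 6 6)))

-- The cost of cutting. The core has at most 10 ℓ T′ edges, and the division by t brings t^6 down to
-- t^5; 640 is 10 · 64.
cut-bound : ∀ {t ℓ T′ C} → 1 ≤ t → 1 ≤ ℓ → 1 ≤ T′ → T′ ≤ 64 * t ^ 6 → t * C ≤ 4 * ((ℓ + ℓ) * T′) + suc T′ →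
            C ≤ 640 * (t ^ 5 * ℓ ^ 2)
cut-bound {t} {ℓ} {T′} {C} t>0 ℓ>0 T′>0 T′≤ tC≤ = *-cancelˡ-≤ t {{>-nonZero t>0}} (begin
  t * C                                ≤⟨ tC≤ ⟩
  4 * ((ℓ + ℓ) * T′) + suc T′          ≤⟨ +-monoʳ-≤ (4 * ((ℓ + ℓ) * T′)) (+-mono-≤ (*-mono-≤ ℓ>0 T′>0) (m≤n*m T′ ℓ {{>-nonZero ℓ>0}})) ⟩
  4 * ((ℓ + ℓ) * T′) + (ℓ * T′ + ℓ * T′) ≡⟨ arith₁ ℓ T′ ⟩
  10 * (ℓ * T′)                        ≤⟨ *-monoʳ-≤ 10 (*-mono-≤ ℓ≤ℓ² T′≤) ⟩
  10 * (ℓ ^ 2 * (64 * t ^ 6))          ≡⟨ arith₂ t (t ^ 5) (ℓ ^ 2) ⟩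
  t * (640 * (t ^ 5 * ℓ ^ 2))          ∎)
  where
  open ≤-Reasoning
  ℓ≤ℓ² : ℓ ≤ ℓ ^ 2
  ℓ≤ℓ² = ≤-trans (m≤m*n ℓ ℓ {{>-nonZero ℓ>0}}) (≤-reflexive (cong (ℓ *_) (sym (*-identityʳ ℓ))))
  arith₁ : ∀ ℓ T → 4 * ((ℓ + ℓ) * T) + (ℓ * T + ℓ * T) ≡ 10 * (ℓ * T)
  arith₁ = solve-∀
  arith₂ : ∀ t p l → 10 * (l * (64 * (t * p))) ≡ t * (640 * (p * l))
  arith₂ = solve-∀

-- The constant is 768 + 2 · 640 + 4, the last term absorbing the share of the vertex 1.
error-bound : ∀ {n P t ℓ T T′} → 1 ≤ t → 1 ≤ ℓ → 1 ≤ T′ → T ≤ 16 * t ^ 4 → T′ ≤ 64 * t ^ 6 →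
              (∃[ C ] t * C ≤ 4 * ((ℓ + ℓ) * T′) + suc T′ ×
                2 * n ≤ 2 * (trailLength (t * suc ℓ) * ((ℓ + ℓ) * T)) + (2 * C + 4) + P) →
              2 * n ∸ P ≤ 2052 * (t ^ 5 * ℓ ^ 2)
error-bound {n} {P} {t} {ℓ} {T} {T′} t>0 ℓ>0 T′>0 T≤ T′≤ (C , tC≤ , bound) = m≤n+o⇒m∸n≤o (2 * n) P (begin
  2 * n                                  ≤⟨ bound ⟩
  error + P                              ≤⟨ +-monoˡ-≤ P (+-mono-≤ (trails-bound {t} {ℓ} {T} t>0 ℓ>0 T≤)
                                              (+-mono-≤ (*-monoʳ-≤ 2 (cut-bound {t} {ℓ} {T′} {C} t>0 ℓ>0 T′>0 T′≤ tC≤)) (*-monoʳ-≤ 4 q>0))) ⟩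
  768 * q + (2 * (640 * q) + 4 * q) + P  ≡⟨ arith q P ⟩
  P + 2052 * q                           ∎)
  where
  open ≤-Reasoning
  q = t ^ 5 * ℓ ^ 2
  error = 2 * (trailLength (t * suc ℓ) * ((ℓ + ℓ) * T)) + (2 * C + 4)
  q>0 : 1 ≤ q
  q>0 = *-mono-≤ (m^n>0 t {{>-nonZero t>0}} 5) (m^n>0 ℓ {{>-nonZero ℓ>0}} 2)
  arith : ∀ q P → 768 * q + (2 * (640 * q) + 4 * q) + P ≡ P + 2052 * q
  arith = solve-∀

excess : ∀ {n} → ℕ → (Fin n → ℕ) → ℕ
excess {n} N A = 2 * n ∸ (2 * primeCount N + primeCountSqrt N + squarePrimeCount N A)

-- With T = s^4 and T′ = s^6 the single inequality N < s^12 says both N < T³ and N < T′².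
excess-bound : ∀ {N n} (A : Fin n → ℕ) → SubsetOfRange N A → DistinctSubsetProducts A → ∀ {t s ℓ} →
               1 ≤ N → 1 ≤ t → s ≤ 2 * t → 1 ≤ ℓ → N < s ^ 12 → N < 2 ^ ℓ → excess N A ≤ 2052 * (t ^ 5 * ℓ ^ 2)
excess-bound {N} {n} A range products {t} {s} {ℓ} N>0 t>0 s≤2t ℓ>0 N<s¹² N<2^ℓ =
  error-bound {n} {2 * primeCount N + primeCountSqrt N + squarePrimeCount N A} {t} {ℓ} {s ^ 4} {s ^ 6} t>0 ℓ>0 (m^n>0 s 6)
    (≤-trans (^-monoˡ-≤ 4 s≤2t) (≤-reflexive (^-distribʳ-* 2 t 4)))
    (≤-trans (^-monoˡ-≤ 6 s≤2t) (≤-reflexive (^-distribʳ-* 2 t 6)))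
    (Decomposed.deficit A range products {t} {ℓ} {s ^ 4} {s ^ 6} t>0 N>0 (^-monoʳ-≤ s (m≤m+n 4 2))
      (subst (N <_) (trans (^-distribˡ-+-* s 8 4) (cong (_* s ^ 4) (^-distribˡ-+-* s 4 4))) N<s¹²)
      (subst (N <_) (^-distribˡ-+-* s 6 6) N<s¹²) N<2^ℓ)
  where
  instance
    s≢0 : NonZero s
    s≢0 = ≢-nonZero λ { refl → <⇒≱ N<s¹² z≤n }

-- The power 12b turns t^5 into (t^12)^(5b), at most N^(5b), and ℓ² into (ℓ^(2b))^12, at most (D
-- N)^12. The factor N^12 fits into N^(12a), and D^12 is raised to D^(12b) to join the constant.
power-bound : ∀ {X N t ℓ D} a b → 1 ≤ a → 1 ≤ b → 1 ≤ D → 1 ≤ N → t ^ 12 ≤ N → ℓ ^ (2 * b) ≤ D * N →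
              ∀ K → X ≤ K * (t ^ 5 * ℓ ^ 2) → X ^ (12 * b) ≤ (K * D) ^ (12 * b) * N ^ (5 * b + 12 * a)
power-bound {X} {N} {t} {ℓ} {D} a b a>0 b>0 D>0 N>0 t≤ ℓ≤ K X≤ = begin
  X ^ (12 * b)                                                         ≤⟨ ^-monoˡ-≤ (12 * b) X≤ ⟩
  (K * (t ^ 5 * ℓ ^ 2)) ^ (12 * b)                                     ≡⟨ ^-distribʳ-* K _ (12 * b) ⟩
  K ^ (12 * b) * (t ^ 5 * ℓ ^ 2) ^ (12 * b)                            ≡⟨ cong (K ^ (12 * b) *_) (^-distribʳ-* (t ^ 5) (ℓ ^ 2) (12 * b)) ⟩
  K ^ (12 * b) * ((t ^ 5) ^ (12 * b) * (ℓ ^ 2) ^ (12 * b))             ≡⟨ cong (K ^ (12 * b) *_) (cong₂ _*_ (exchange t 5 12) (exchange ℓ 2 12)) ⟩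
  K ^ (12 * b) * ((t ^ 12) ^ (5 * b) * (ℓ ^ 12) ^ (2 * b))             ≡⟨ cong (λ p → K ^ (12 * b) * ((t ^ 12) ^ (5 * b) * p)) (^-comm ℓ 12 (2 * b)) ⟩
  K ^ (12 * b) * ((t ^ 12) ^ (5 * b) * (ℓ ^ (2 * b)) ^ 12)             ≤⟨ *-monoʳ-≤ (K ^ (12 * b)) (*-mono-≤ (^-monoˡ-≤ (5 * b) t≤) (^-monoˡ-≤ 12 ℓ≤)) ⟩
  K ^ (12 * b) * (N ^ (5 * b) * (D * N) ^ 12)                          ≡⟨ cong (λ p → K ^ (12 * b) * (N ^ (5 * b) * p)) (^-distribʳ-* D N 12) ⟩
  K ^ (12 * b) * (N ^ (5 * b) * (D ^ 12 * N ^ 12))                     ≤⟨ *-monoʳ-≤ (K ^ (12 * b)) (*-monoʳ-≤ (N ^ (5 * b))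
                                                                            (*-mono-≤ (raise D>0 b>0) (raise N>0 a>0))) ⟩
  K ^ (12 * b) * (N ^ (5 * b) * (D ^ (12 * b) * N ^ (12 * a)))         ≡⟨ arith (K ^ (12 * b)) (N ^ (5 * b)) (D ^ (12 * b)) (N ^ (12 * a)) ⟩
  K ^ (12 * b) * D ^ (12 * b) * (N ^ (5 * b) * N ^ (12 * a))           ≡⟨ cong₂ _*_ (^-distribʳ-* K D (12 * b)) (^-distribˡ-+-* N (5 * b) (12 * a)) ⟨
  (K * D) ^ (12 * b) * N ^ (5 * b + 12 * a)                            ∎
  where
  open ≤-Reasoning
  ^-comm : ∀ m i j → (m ^ i) ^ j ≡ (m ^ j) ^ i
  ^-comm m i j = trans (^-*-assoc m i j) (trans (cong (m ^_) (*-comm i j)) (sym (^-*-assoc m j i)))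
  exchange : ∀ m i j → (m ^ i) ^ (j * b) ≡ (m ^ j) ^ (i * b)
  exchange m i j = trans (^-*-assoc m i (j * b)) (trans (cong (m ^_) (x∙yz≈y∙xz i j b)) (sym (^-*-assoc m j (i * b))))
  raise : ∀ {m c} → 1 ≤ m → 1 ≤ c → m ^ 12 ≤ m ^ (12 * c)
  raise {m} {c} m>0 c>0 = ^-monoʳ-≤ m {{>-nonZero m>0}} (m≤m*n 12 c {{>-nonZero c>0}})
  arith : ∀ p q r s → p * (q * (r * s)) ≡ p * r * (q * s)
  arith = solve-∀

positive-bound : ∀ a b → 1 ≤ a → 1 ≤ b → ∀ {D} → 1 ≤ D → (∀ ℓ → ℓ ^ (2 * b) ≤ D * 2 ^ ℓ) →
                 ∀ {N n} (A : Fin n → ℕ) → 1 ≤ N → SubsetOfRange N A → DistinctSubsetProducts A →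
                 (∃₂ λ t s → 1 ≤ t × s ≤ 2 * t × t ^ 12 ≤ N × N < s ^ 12) →
                 (∃[ ℓ ] 1 ≤ ℓ × N < 2 ^ ℓ × 2 ^ ℓ ≤ 2 * N) →
                 excess N A ^ (12 * b) ≤ (2052 * (D * 2)) ^ (12 * b) * N ^ (5 * b + 12 * a)
positive-bound a b a>0 b>0 {D} D>0 growth {N} A N>0 range products (t , s , t>0 , s≤2t , t≤ , N<s) (ℓ , ℓ>0 , N<2^ℓ , 2^ℓ≤) =
  power-bound {excess N A} {N} {t} {ℓ} {D * 2} a b a>0 b>0 (*-mono-≤ D>0 (s≤s z≤n)) N>0 t≤
    (≤-trans (growth ℓ) (≤-trans (*-monoʳ-≤ D 2^ℓ≤) (≤-reflexive (sym (*-assoc D 2 N)))))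
    2052 (excess-bound A range products {t} {s} {ℓ} N>0 t>0 s≤2t ℓ>0 N<s N<2^ℓ)

n≡0⊎N>0 : ∀ {N n} {A : Fin n → ℕ} → SubsetOfRange N A → n ≡ 0 ⊎ 1 ≤ N
n≡0⊎N>0 {n = zero} _ = inj₁ refl
n≡0⊎N>0 {n = suc _} (_ , range) = inj₂ (≤-trans (proj₁ (range fzero)) (proj₂ (range fzero)))

0∸m^k≤ : ∀ m {k o} .{{_ : NonZero k}} → (0 ∸ m) ^ k ≤ o
0∸m^k≤ m {suc k} rewrite 0∸n≡0 m = z≤n

-- With ε = a / b, the inequality is doubled to clear the halves and raised to the power 12b to
-- clear the exponent 5/12 + ε. Truncated subtraction is faithful, as a negative difference makes
-- the claim trivial.
theorem2p7 : (a b : ℕ) → 1 ≤ a → 1 ≤ b →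
    Σ ℕ λ C → (N n : ℕ) (A : Fin n → ℕ) → SubsetOfRange N A → DistinctSubsetProducts A →
    ((2 * n) ∸ (2 * primeCount N + primeCountSqrt N + squarePrimeCount N A)) ^ (12 * b)
    ≤ (2 * C) ^ (12 * b) * N ^ (5 * b + 12 * a)
theorem2p7 a b a>0 b>0 = C , λ N n A range products → bound N n A range products (n≡0⊎N>0 range)
  where
  instance
    b≢0 : NonZero b
    b≢0 = >-nonZero b>0
    2b≢0 : NonZero (2 * b)
    2b≢0 = m*n≢0 2 b
    12b≢0 : NonZero (12 * b)
    12b≢0 = m*n≢0 12 b
  -- `D` bounds ℓ^(2b) by D * 2 ^ ℓ, and 2 ^ ℓ ≤ 2 * N supplies the factor 2 beside it in `C`.
  D = (2 * b) ^ (2 * b)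
  C = 2052 * (D * 2)
  bound : ∀ N n (A : Fin n → ℕ) → SubsetOfRange N A → DistinctSubsetProducts A → n ≡ 0 ⊎ 1 ≤ N →
          excess N A ^ (12 * b) ≤ (2 * C) ^ (12 * b) * N ^ (5 * b + 12 * a)
  bound N .0 A range products (inj₁ refl) = 0∸m^k≤ (2 * primeCount N + primeCountSqrt N + squarePrimeCount N A) {12 * b}
  bound N n A range products (inj₂ N>0) = ≤-trans
    (positive-bound a b a>0 b>0 {D} (m^n>0 (2 * b) (2 * b)) (power≤exponential (2 * b)) A N>0 range products
      (root-bracket 12 N N>0) (log-ceil N N>0))
    (*-monoˡ-≤ (N ^ (5 * b + 12 * a)) (^-monoˡ-≤ (12 * b) (m≤n*m C 2)))
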